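{- Let $\mathbb K$ be a field of characteristic $p>2$ with prime subfield $\mathbb F_p$, $n,r\ge1$, $\Lambda_1,\dots,\Lambda_n\in\mathbb F_p$, $a\in\mathbb F_p^\times$, $\kappa=1$. The function $$F(s,x)=\prod_{m=1}^n\prod_{l=1}^r g(s_l-x_m,\Lambda_m)\cdot\prod_{1\le j<l\le r}\bigl((s_l-s_j)\,g(s_l-s_j+1,-2)\bigr)$$ is a polynomial in $s=(s_1,\dots,s_r)$ and $x=(x_1,\dots,x_n)$. Furthermore, $F$ is a master function for the connection $(\Phi_l,\Psi_m)$, that is, $$\Phi_l(s,x)=\frac{F(s+ae_l,x)}{F(s,x)},\qquad\Psi_m(s,x)=\frac{F(s,x+af_m)}{F(s,x)}$$ for $l=1,\dots,r$ and $m=1,\dots,n$.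
   Context: For $b\in\mathbb F_p$ let $\bar b\in\{1,\dots,p\}$ be such that $a\bar b=b$ in $\mathbb F_p$, and set $g(y,b)=(y+b-a)\cdots(y+2a)(y+a)$, the product of the $\bar b-1$ factors $y+ia$, $i=1,\dots,\bar b-1$. With $\kappa=1$, $$\Phi_l(s,x)=\prod_{i=1}^n\frac{s_l-x_i+\Lambda_i}{s_l-x_i+a}\prod_{j\ne l}\frac{(s_l-s_j+a)(s_l-s_j-1)}{(s_l-s_j)(s_l-s_j+1+a)},\qquad \Psi_m(s,x)=\prod_{j=1}^r\frac{s_j-x_m}{s_j-x_m+\Lambda_m-a}.$$ Here $s+ae_l$ (resp. $x+af_m$) is $s$ (resp. $x$) with the $l$-th (resp. $m$-th) coordinate increased by $a$. -}

module Defs where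

open import Level using (Level; _⊔_) renaming (suc to lsuc)
open import Algebra.Bundles using (CommutativeRing; AbelianGroup)
open import Algebra.Apartness.Bundles using (HeytingField; HeytingCommutativeRing)
open import Data.Empty using (⊥)
open import Data.Fin.Base as Fin using (Fin; zero; suc; toℕ; _↑ˡ_; _↑ʳ_)
import Data.Fin.Properties as Fin
open import Data.List.Base using (List; []; _∷_; map)
open import Data.Nat.Base as ℕ using (ℕ; zero; suc; NonZero; _∸_; _≤_; _<_; z≤n; s≤s)
import Data.Nat.Properties as ℕ
open import Data.Nat.Coprimality using (Coprime; coprime-Bézout)
open import Data.Nat.Divisibility using (_∣_; divides; ∣-refl; ∣⇒≤)
open import Data.Nat.DivMod using (_%_; _/_; m≡m%n+[m/n]*n; m%n<n)
open import Data.Nat.GCD using (module Bézout)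
open import Data.Nat.Primality using (Prime; prime; composite; prime⇒irreducible)
open import Data.Product using (Σ; ∃; _×_; _,_; proj₁; proj₂)
open import Data.Sum using (inj₁; inj₂)
open import Data.Vec.Functional using (Vector; updateAt)
open import Function.Bundles using (_⇔_; Equivalence)
open import Relation.Binary.PropositionalEquality as ≡ using (_≡_; _≢_)
open import Relation.Nullary using (¬_; Dec; yes; no; contradiction; ¬?)
import Algebra.Definitions.RawMonoid as RawMonoidDefs
import Algebra.Properties.Group as GroupProps
import Algebra.Properties.Monoid.Mult as MultProps
import Algebra.Properties.Ring as RingProps
import Algebra.Properties.Semiring.Mult as SemiringMultProps
import Algebra.Properties.CommutativeSemigroup as CSProps
import Relation.Binary.Reasoning.Setoid as SetoidReasoning
import Algebra.Solver.Ring.NaturalCoefficients.Default as Solver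

private
  variable
    c ℓ ℓ₁ ℓ₂ : Level

  by-cases : {A : Set ℓ} → (A → ⊥) → (¬ A → ⊥) → ⊥
  by-cases f g = g f

-- Equality is required to be ¬¬-stable because cancellation (hence transitivity
-- of equality of fractions) is not constructively derivable from the absence of
-- zero divisors alone.  Classically the field ≈-stable is void.
record IntegralDomain (c ℓ : Level) : Set (lsuc (c ⊔ ℓ)) where
  field
    commutativeRing : CommutativeRing c ℓ

  open CommutativeRing commutativeRing public

  field
    1≉0            : ¬ 1# ≈ 0#
    noZeroDivisors : ∀ {x y} → ¬ x ≈ 0# → ¬ y ≈ 0# → ¬ x * y ≈ 0#
    ≈-stable       : ∀ {x y} → ¬ ¬ x ≈ y → x ≈ y

  *-cancelˡ : ∀ {x y z} → ¬ x ≈ 0# → x * y ≈ x * z → y ≈ z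
  *-cancelˡ {x} {y} {z} x≉0 xy≈xz = ≈-stable λ y≉z →
    noZeroDivisors x≉0
      (λ y-z≈0 → y≉z (GroupProps.x∙y⁻¹≈ε⇒x≈y +-group y z y-z≈0))
      (trans (RingProps.x[y-z]≈xy-xz ring x y z)
             (GroupProps.x≈y⇒x∙y⁻¹≈ε +-group xy≈xz))

-- R[X]: a polynomial is a list of coefficients, lowest degree first, and two
-- lists are equal when they agree up to trailing zeros.
module Polynomials (R : CommutativeRing c ℓ) where
  open CommutativeRing R

  Poly : Set c
  Poly = List Carrier

  coeff : Poly → ℕ → Carrier
  coeff []      _       = 0#
  coeff (a ∷ f) zero    = a
  coeff (a ∷ f) (suc i) = coeff f i

  infix 4 _≈ₚ_
  record _≈ₚ_ (f g : Poly) : Set ℓ where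
    constructor mk≈
    field coeff≈ : ∀ i → coeff f i ≈ coeff g i
  open _≈ₚ_ public

  infixl 6 _+ₚ_
  infixl 7 _*ₚ_ _·_

  _+ₚ_ : Poly → Poly → Poly
  []      +ₚ g       = g
  (a ∷ f) +ₚ []      = a ∷ f
  (a ∷ f) +ₚ (b ∷ g) = (a + b) ∷ (f +ₚ g)

  -ₚ_ : Poly → Poly
  -ₚ f = map (λ a → - a) f

  _·_ : Carrier → Poly → Poly
  a · g = map (a *_) g

  _*ₚ_ : Poly → Poly → Poly
  []      *ₚ g = []
  (a ∷ f) *ₚ g = a · g +ₚ (0# ∷ f *ₚ g)

  private
    coeff-+ : ∀ f g i → coeff (f +ₚ g) i ≈ coeff f i + coeff g i
    coeff-+ []      g       i       = sym (+-identityˡ _)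
    coeff-+ (a ∷ f) []      i       = sym (+-identityʳ _)
    coeff-+ (a ∷ f) (b ∷ g) zero    = refl
    coeff-+ (a ∷ f) (b ∷ g) (suc i) = coeff-+ f g i

    coeff-neg : ∀ f i → coeff (-ₚ f) i ≈ - coeff f i
    coeff-neg []      i       = sym (GroupProps.ε⁻¹≈ε +-group)
    coeff-neg (a ∷ f) zero    = refl
    coeff-neg (a ∷ f) (suc i) = coeff-neg f i

    coeff-· : ∀ a f i → coeff (a · f) i ≈ a * coeff f i
    coeff-· a []      i       = sym (zeroʳ a)
    coeff-· a (b ∷ f) zero    = refl
    coeff-· a (b ∷ f) (suc i) = coeff-· a f i

    reflₚ : ∀ {f} → f ≈ₚ f
    reflₚ = mk≈ λ i → refl

    symₚ : ∀ {f g} → f ≈ₚ g → g ≈ₚ f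
    symₚ (mk≈ p) = mk≈ λ i → sym (p i)

    transₚ : ∀ {f g h} → f ≈ₚ g → g ≈ₚ h → f ≈ₚ h
    transₚ (mk≈ p) (mk≈ q) = mk≈ λ i → trans (p i) (q i)

    +ₚ-cong : ∀ {f f′ g g′} → f ≈ₚ f′ → g ≈ₚ g′ → f +ₚ g ≈ₚ f′ +ₚ g′
    +ₚ-cong {f} {f′} {g} {g′} (mk≈ p) (mk≈ q) = mk≈ λ i →
      trans (coeff-+ f g i) (trans (+-cong (p i) (q i)) (sym (coeff-+ f′ g′ i)))

    +ₚ-assoc : ∀ f g h → (f +ₚ g) +ₚ h ≈ₚ f +ₚ (g +ₚ h)
    +ₚ-assoc f g h = mk≈ λ i →
      trans (coeff-+ (f +ₚ g) h i)
      (trans (+-congʳ (coeff-+ f g i))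
      (trans (+-assoc _ _ _)
      (trans (+-congˡ (sym (coeff-+ g h i))) (sym (coeff-+ f (g +ₚ h) i)))))

    +ₚ-comm : ∀ f g → f +ₚ g ≈ₚ g +ₚ f
    +ₚ-comm f g = mk≈ λ i →
      trans (coeff-+ f g i) (trans (+-comm _ _) (sym (coeff-+ g f i)))

    +ₚ-identityʳ : ∀ f → f +ₚ [] ≈ₚ f
    +ₚ-identityʳ f = +ₚ-comm f []

    -ₚ-cong : ∀ {f g} → f ≈ₚ g → -ₚ f ≈ₚ -ₚ g
    -ₚ-cong {f} {g} (mk≈ p) = mk≈ λ i →
      trans (coeff-neg f i) (trans (-‿cong (p i)) (sym (coeff-neg g i)))

    -ₚ-inverseˡ : ∀ f → (-ₚ f) +ₚ f ≈ₚ []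
    -ₚ-inverseˡ f = mk≈ λ i →
      trans (coeff-+ (-ₚ f) f i) (trans (+-congʳ (coeff-neg f i)) (-‿inverseˡ _))

  +ₚ-abelianGroup : AbelianGroup c ℓ
  +ₚ-abelianGroup = record
    { Carrier = Poly ; _≈_ = _≈ₚ_ ; _∙_ = _+ₚ_ ; ε = [] ; _⁻¹ = -ₚ_
    ; isAbelianGroup = record
      { isGroup = record
        { isMonoid = record
          { isSemigroup = record
            { isMagma = record
              { isEquivalence = record { refl = reflₚ ; sym = symₚ ; trans = transₚ }
              ; ∙-cong = +ₚ-cong }
            ; assoc = +ₚ-assoc }
          ; identity = (λ f → reflₚ) , +ₚ-identityʳ }
        ; inverse = -ₚ-inverseˡ , λ f → transₚ (+ₚ-comm f (-ₚ f)) (-ₚ-inverseˡ f)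
        ; ⁻¹-cong = -ₚ-cong }
      ; comm = +ₚ-comm } }

  private
    module P = AbelianGroup +ₚ-abelianGroup
    open SetoidReasoning P.setoid

    +ₚ-interchange : ∀ f g h k → (f +ₚ g) +ₚ (h +ₚ k) ≈ₚ (f +ₚ h) +ₚ (g +ₚ k)
    +ₚ-interchange = CSProps.interchange P.commutativeSemigroup

    ∷-cong : ∀ {a b f g} → a ≈ b → f ≈ₚ g → a ∷ f ≈ₚ b ∷ g
    ∷-cong p (mk≈ q) = mk≈ λ { zero → p ; (suc i) → q i }

    0∷[]≈[] : 0# ∷ [] ≈ₚ []
    0∷[]≈[] = mk≈ λ { zero → refl ; (suc i) → refl }

    0∷-+ : ∀ f g → 0# ∷ (f +ₚ g) ≈ₚ (0# ∷ f) +ₚ (0# ∷ g)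
    0∷-+ f g = ∷-cong (sym (+-identityˡ 0#)) reflₚ

    tail-≈ : ∀ {a b f g} → a ∷ f ≈ₚ b ∷ g → f ≈ₚ g
    tail-≈ (mk≈ p) = mk≈ λ i → p (suc i)

    tail-≈[] : ∀ {a f} → a ∷ f ≈ₚ [] → f ≈ₚ []
    tail-≈[] (mk≈ p) = mk≈ λ i → p (suc i)

    ·-cong : ∀ {a b f g} → a ≈ b → f ≈ₚ g → a · f ≈ₚ b · g
    ·-cong {a} {b} {f} {g} p (mk≈ q) = mk≈ λ i →
      trans (coeff-· a f i) (trans (*-cong p (q i)) (sym (coeff-· b g i)))

    ·-distribˡ : ∀ a f g → a · (f +ₚ g) ≈ₚ a · f +ₚ a · g
    ·-distribˡ a f g = mk≈ λ i →
      trans (coeff-· a (f +ₚ g) i)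
      (trans (*-congˡ (coeff-+ f g i))
      (trans (distribˡ _ _ _)
      (trans (sym (+-cong (coeff-· a f i) (coeff-· a g i))) (sym (coeff-+ (a · f) (a · g) i)))))

    ·-distribʳ : ∀ a b f → (a + b) · f ≈ₚ a · f +ₚ b · f
    ·-distribʳ a b f = mk≈ λ i →
      trans (coeff-· (a + b) f i)
      (trans (distribʳ _ _ _)
      (trans (sym (+-cong (coeff-· a f i) (coeff-· b f i))) (sym (coeff-+ (a · f) (b · f) i))))

    ·-assoc : ∀ a b f → (a * b) · f ≈ₚ a · (b · f)
    ·-assoc a b f = mk≈ λ i →
      trans (coeff-· (a * b) f i)
      (trans (*-assoc _ _ _)
      (trans (*-congˡ (sym (coeff-· b f i))) (sym (coeff-· a (b · f) i))))

    0·f≈[] : ∀ {a} f → a ≈ 0# → a · f ≈ₚ []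
    0·f≈[] {a} f p = mk≈ λ i → trans (coeff-· a f i) (trans (*-congʳ p) (zeroˡ _))

    1·f≈f : ∀ f → 1# · f ≈ₚ f
    1·f≈f f = mk≈ λ i → trans (coeff-· 1# f i) (*-identityˡ _)

    ·-0∷ : ∀ a f → a · (0# ∷ f) ≈ₚ 0# ∷ a · f
    ·-0∷ a f = ∷-cong (zeroʳ a) reflₚ

    *ₚ-zeroˡ : ∀ f g → f ≈ₚ [] → f *ₚ g ≈ₚ []
    *ₚ-zeroˡ []      g p = reflₚ
    *ₚ-zeroˡ (a ∷ f) g p = begin
      a · g +ₚ (0# ∷ f *ₚ g) ≈⟨ P.∙-cong (0·f≈[] g (coeff≈ p 0)) (∷-cong refl (*ₚ-zeroˡ f g (tail-≈[] p))) ⟩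
      0# ∷ []                ≈⟨ 0∷[]≈[] ⟩
      []                     ∎

    *ₚ-zeroʳ : ∀ f → f *ₚ [] ≈ₚ []
    *ₚ-zeroʳ []      = reflₚ
    *ₚ-zeroʳ (a ∷ f) = transₚ (∷-cong refl (*ₚ-zeroʳ f)) 0∷[]≈[]

    *ₚ-congˡ : ∀ f {g h} → g ≈ₚ h → f *ₚ g ≈ₚ f *ₚ h
    *ₚ-congˡ []      p = reflₚ
    *ₚ-congˡ (a ∷ f) p = P.∙-cong (·-cong refl p) (∷-cong refl (*ₚ-congˡ f p))

    *ₚ-congʳ : ∀ f f′ g → f ≈ₚ f′ → f *ₚ g ≈ₚ f′ *ₚ g
    *ₚ-congʳ []      f′       g p = symₚ (*ₚ-zeroˡ f′ g (symₚ p))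
    *ₚ-congʳ (a ∷ f) []       g p = *ₚ-zeroˡ (a ∷ f) g p
    *ₚ-congʳ (a ∷ f) (b ∷ f′) g p =
      P.∙-cong (·-cong (coeff≈ p 0) reflₚ) (∷-cong refl (*ₚ-congʳ f f′ g (tail-≈ p)))

    *ₚ-distribʳ : ∀ h f g → (f +ₚ g) *ₚ h ≈ₚ f *ₚ h +ₚ g *ₚ h
    *ₚ-distribʳ h []      g       = reflₚ
    *ₚ-distribʳ h (a ∷ f) []      = symₚ (+ₚ-identityʳ _)
    *ₚ-distribʳ h (a ∷ f) (b ∷ g) = begin
      (a + b) · h +ₚ (0# ∷ (f +ₚ g) *ₚ h)
        ≈⟨ P.∙-cong (·-distribʳ a b h) (transₚ (∷-cong refl (*ₚ-distribʳ h f g)) (0∷-+ (f *ₚ h) (g *ₚ h))) ⟩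
      (a · h +ₚ b · h) +ₚ ((0# ∷ f *ₚ h) +ₚ (0# ∷ g *ₚ h))
        ≈⟨ +ₚ-interchange (a · h) (b · h) _ _ ⟩
      (a ∷ f) *ₚ h +ₚ (b ∷ g) *ₚ h ∎

    *ₚ-∷ : ∀ f b g → f *ₚ (b ∷ g) ≈ₚ b · f +ₚ (0# ∷ f *ₚ g)
    *ₚ-∷ []      b g = symₚ 0∷[]≈[]
    *ₚ-∷ (a ∷ f) b g = ∷-cong (+-congʳ (*-comm a b)) (begin
      a · g +ₚ f *ₚ (b ∷ g)              ≈⟨ P.∙-congˡ (*ₚ-∷ f b g) ⟩
      a · g +ₚ (b · f +ₚ (0# ∷ f *ₚ g))  ≈⟨ CSProps.x∙yz≈y∙xz P.commutativeSemigroup (a · g) (b · f) _ ⟩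
      b · f +ₚ (a · g +ₚ (0# ∷ f *ₚ g))  ∎)

    *ₚ-comm : ∀ f g → f *ₚ g ≈ₚ g *ₚ f
    *ₚ-comm []      g = symₚ (*ₚ-zeroʳ g)
    *ₚ-comm (a ∷ f) g = transₚ (P.∙-congˡ (∷-cong refl (*ₚ-comm f g))) (symₚ (*ₚ-∷ g a f))

    ·-*ₚ : ∀ a f g → (a · f) *ₚ g ≈ₚ a · (f *ₚ g)
    ·-*ₚ a []      g = reflₚ
    ·-*ₚ a (b ∷ f) g = begin
      (a * b) · g +ₚ (0# ∷ (a · f) *ₚ g)   ≈⟨ P.∙-cong (·-assoc a b g) (∷-cong refl (·-*ₚ a f g)) ⟩
      a · (b · g) +ₚ (0# ∷ a · (f *ₚ g))   ≈⟨ P.∙-congˡ (symₚ (·-0∷ a (f *ₚ g))) ⟩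
      a · (b · g) +ₚ a · (0# ∷ f *ₚ g)     ≈⟨ ·-distribˡ a (b · g) (0# ∷ f *ₚ g) ⟨
      a · (b · g +ₚ (0# ∷ f *ₚ g))         ∎

    0∷-*ₚ : ∀ {a} f g → a ≈ 0# → (a ∷ f) *ₚ g ≈ₚ 0# ∷ f *ₚ g
    0∷-*ₚ f g p = P.∙-congʳ (0·f≈[] g p)

    *ₚ-assoc : ∀ f g h → (f *ₚ g) *ₚ h ≈ₚ f *ₚ (g *ₚ h)
    *ₚ-assoc []      g h = reflₚ
    *ₚ-assoc (a ∷ f) g h = begin
      (a · g +ₚ (0# ∷ f *ₚ g)) *ₚ h         ≈⟨ *ₚ-distribʳ h (a · g) _ ⟩
      (a · g) *ₚ h +ₚ (0# ∷ f *ₚ g) *ₚ h    ≈⟨ P.∙-cong (·-*ₚ a g h) (0∷-*ₚ (f *ₚ g) h refl) ⟩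
      a · (g *ₚ h) +ₚ (0# ∷ (f *ₚ g) *ₚ h)  ≈⟨ P.∙-congˡ (∷-cong refl (*ₚ-assoc f g h)) ⟩
      a · (g *ₚ h) +ₚ (0# ∷ f *ₚ (g *ₚ h))  ∎

    *ₚ-identityˡ : ∀ f → (1# ∷ []) *ₚ f ≈ₚ f
    *ₚ-identityˡ f = begin
      1# · f +ₚ (0# ∷ []) ≈⟨ P.∙-cong (1·f≈f f) 0∷[]≈[] ⟩
      f +ₚ []             ≈⟨ +ₚ-identityʳ f ⟩
      f                   ∎

    *ₚ-distribˡ : ∀ f g h → f *ₚ (g +ₚ h) ≈ₚ f *ₚ g +ₚ f *ₚ h
    *ₚ-distribˡ f g h =
      transₚ (*ₚ-comm f (g +ₚ h))
      (transₚ (*ₚ-distribʳ f g h) (P.∙-cong (*ₚ-comm g f) (*ₚ-comm h f)))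

  polyRing : CommutativeRing c ℓ
  polyRing = record
    { Carrier = Poly ; _≈_ = _≈ₚ_ ; _+_ = _+ₚ_ ; _*_ = _*ₚ_
    ; -_ = -ₚ_ ; 0# = [] ; 1# = 1# ∷ []
    ; isCommutativeRing = record
      { isRing = record
        { +-isAbelianGroup = P.isAbelianGroup
        ; *-cong = λ {f} {f′} {g} {g′} p q → transₚ (*ₚ-congʳ f f′ g p) (*ₚ-congˡ f′ q)
        ; *-assoc = *ₚ-assoc
        ; *-identity = *ₚ-identityˡ , λ f → transₚ (*ₚ-comm f _) (*ₚ-identityˡ f)
        ; distrib = *ₚ-distribˡ , *ₚ-distribʳ }
      ; *-comm = *ₚ-comm } }

  module _ (nzd : ∀ {x y} → ¬ x ≈ 0# → ¬ y ≈ 0# → ¬ x * y ≈ 0#) where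

    *ₚ-noZeroDivisors : ∀ f g → ¬ f ≈ₚ [] → ¬ g ≈ₚ [] → ¬ f *ₚ g ≈ₚ []
    *ₚ-noZeroDivisors []      g       f≉0 g≉0 fg≈0 = f≉0 reflₚ
    *ₚ-noZeroDivisors (a ∷ f) []      f≉0 g≉0 fg≈0 = g≉0 reflₚ
    *ₚ-noZeroDivisors (a ∷ f) (b ∷ g) f≉0 g≉0 fg≈0 = by-cases
      (λ a≈0 → *ₚ-noZeroDivisors f (b ∷ g)
        (λ f≈0 → f≉0 (transₚ (∷-cong a≈0 f≈0) 0∷[]≈[])) g≉0
        (tail-≈[] (transₚ (symₚ (0∷-*ₚ f (b ∷ g) a≈0)) fg≈0)))
      (λ a≉0 → by-cases
        (λ b≈0 → *ₚ-noZeroDivisors (a ∷ f) g f≉0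
          (λ g≈0 → g≉0 (transₚ (∷-cong b≈0 g≈0) 0∷[]≈[]))
          (tail-≈[] (transₚ
            (symₚ (transₚ (*ₚ-comm (a ∷ f) (b ∷ g))
                  (transₚ (0∷-*ₚ g (a ∷ f) b≈0) (∷-cong refl (*ₚ-comm g (a ∷ f))))))
            fg≈0)))
        (λ b≉0 → nzd a≉0 b≉0 (trans (sym (+-identityʳ _)) (coeff≈ fg≈0 0))))

polyDomain : IntegralDomain c ℓ → IntegralDomain c ℓ
polyDomain D = record
  { commutativeRing = polyRing
  ; 1≉0 = λ p → 1≉0 (coeff≈ p 0)
  ; noZeroDivisors = λ {f} {g} → *ₚ-noZeroDivisors noZeroDivisors f g
  ; ≈-stable = λ ¬¬p → mk≈ λ i → ≈-stable λ ¬q → ¬¬p λ p → ¬q (coeff≈ p i) }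
  where
  open IntegralDomain D
  open Polynomials commutativeRing

-- D[z₁,…,z_N] as the iterated polynomial ring D[z_N]⋯[z₁].
mPolyDomain : IntegralDomain c ℓ → ℕ → IntegralDomain c ℓ
mPolyDomain D zero    = D
mPolyDomain D (suc N) = polyDomain (mPolyDomain D N)

module MPoly (D : IntegralDomain c ℓ) where
  private
    module D = IntegralDomain D
    module M (N : ℕ) = IntegralDomain (mPolyDomain D N)

  constant : ∀ N → D.Carrier → M.Carrier N
  constant zero    k = k
  constant (suc N) k = constant N k ∷ []

  indeterminate : ∀ {N} → Fin N → M.Carrier N
  indeterminate {suc N} zero    = M.0# N ∷ M.1# N ∷ []
  indeterminate {suc N} (suc i) = indeterminate i ∷ []

  private
    -1≉0 : ∀ N → ¬ M._≈_ N (M.-_ N (M.1# N)) (M.0# N)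
    -1≉0 N p = M.1≉0 N (M.trans N (M.sym N (GroupProps.⁻¹-involutive (M.+-group N) _))
      (M.trans N (M.-‿cong N p) (GroupProps.ε⁻¹≈ε (M.+-group N))))

  difference≉0 : ∀ {N} (i j : Fin N) → i ≢ j → ∀ k →
    ¬ M._≈_ N (M._+_ N (M._-_ N (indeterminate i) (indeterminate j)) (constant N k)) (M.0# N)
  difference≉0 {suc N} zero    zero    i≢j k p = i≢j ≡.refl
  difference≉0 {suc N} zero    (suc j) i≢j k p =
    M.1≉0 N (Polynomials.coeff≈ p 1)
  difference≉0 {suc N} (suc i) zero    i≢j k p =
    -1≉0 N (Polynomials.coeff≈ p 1)
  difference≉0 {suc N} (suc i) (suc j) i≢j k p =
    difference≉0 i j (λ i≡j → i≢j (≡.cong suc i≡j)) k (Polynomials.coeff≈ p 0)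

  constant-cong : ∀ N {k l} → k D.≈ l → M._≈_ N (constant N k) (constant N l)
  constant-cong zero    p = p
  constant-cong (suc N) p =
    Polynomials.mk≈ λ { zero → constant-cong N p ; (suc i) → M.refl N }

  constant-+ : ∀ N k l → M._≈_ N (constant N (k D.+ l)) (M._+_ N (constant N k) (constant N l))
  constant-+ zero    k l = D.refl
  constant-+ (suc N) k l =
    Polynomials.mk≈ λ { zero → constant-+ N k l ; (suc i) → M.refl N }

  constant-neg : ∀ N k → M._≈_ N (constant N (D.- k)) (M.-_ N (constant N k))
  constant-neg zero    k = D.refl
  constant-neg (suc N) k =
    Polynomials.mk≈ λ { zero → constant-neg N k ; (suc i) → M.refl N }

  constant-0 : ∀ N → M._≈_ N (constant N D.0#) (M.0# N)
  constant-0 zero    = D.refl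
  constant-0 (suc N) =
    Polynomials.mk≈ λ { zero → constant-0 N ; (suc i) → M.refl N }

  constant-1 : ∀ N → M._≈_ N (constant N D.1#) (M.1# N)
  constant-1 zero    = D.refl
  constant-1 (suc N) =
    Polynomials.mk≈ λ { zero → constant-1 N ; (suc i) → M.refl N }

module FractionField (D : IntegralDomain c ℓ) where
  open IntegralDomain D
  private
    module S = Solver commutativeSemiring
    open S using (solve) renaming (_:+_ to _⊕_; _:*_ to _⊗_; _:=_ to _⊜_)
    open SetoidReasoning setoid

  record Frac : Set (c ⊔ ℓ) where
    constructor frac
    field
      num den : Carrier
      den≉0   : ¬ den ≈ 0#
  open Frac public

  infix 4 _≈ᶠ_
  record _≈ᶠ_ (u v : Frac) : Set ℓ where
    constructor mk≈ᶠ
    field cross : num u * den v ≈ num v * den u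
  open _≈ᶠ_ public

  _+ᶠ_ _*ᶠ_ : Frac → Frac → Frac
  u +ᶠ v = frac (num u * den v + num v * den u) (den u * den v) (noZeroDivisors (den≉0 u) (den≉0 v))
  u *ᶠ v = frac (num u * num v) (den u * den v) (noZeroDivisors (den≉0 u) (den≉0 v))

  -ᶠ_ : Frac → Frac
  -ᶠ u = frac (- num u) (den u) (den≉0 u)

  embed : Carrier → Frac
  embed x = frac x 1# 1≉0

  private
    ≈ᶠ-trans : ∀ {u v w} → u ≈ᶠ v → v ≈ᶠ w → u ≈ᶠ w
    ≈ᶠ-trans {frac a b _} {frac c d d≉0} {frac e f _} (mk≈ᶠ p) (mk≈ᶠ q) =
      mk≈ᶠ (*-cancelˡ d≉0 (begin
        d * (a * f) ≈⟨ solve 3 (λ d a f → (d ⊗ (a ⊗ f)) ⊜ ((a ⊗ d) ⊗ f)) refl d a f ⟩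
        (a * d) * f ≈⟨ *-congʳ p ⟩
        (c * b) * f ≈⟨ solve 3 (λ c b f → ((c ⊗ b) ⊗ f) ⊜ ((c ⊗ f) ⊗ b)) refl c b f ⟩
        (c * f) * b ≈⟨ *-congʳ q ⟩
        (e * d) * b ≈⟨ solve 3 (λ e d b → ((e ⊗ d) ⊗ b) ⊜ (d ⊗ (e ⊗ b))) refl e d b ⟩
        d * (e * b) ∎))

    +ᶠ-cong : ∀ {u u′ v v′} → u ≈ᶠ u′ → v ≈ᶠ v′ → (u +ᶠ v) ≈ᶠ (u′ +ᶠ v′)
    +ᶠ-cong {frac a b _} {frac a′ b′ _} {frac c d _} {frac c′ d′ _} (mk≈ᶠ p) (mk≈ᶠ q) = mk≈ᶠ (begin
      (a * d + c * b) * (b′ * d′)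
        ≈⟨ solve 6 (λ a b c d b′ d′ → ((a ⊗ d ⊕ c ⊗ b) ⊗ (b′ ⊗ d′)) ⊜ ((a ⊗ b′) ⊗ (d ⊗ d′) ⊕ (c ⊗ d′) ⊗ (b ⊗ b′))) refl a b c d b′ d′ ⟩
      (a * b′) * (d * d′) + (c * d′) * (b * b′)
        ≈⟨ +-cong (*-congʳ p) (*-congʳ q) ⟩
      (a′ * b) * (d * d′) + (c′ * d) * (b * b′)
        ≈⟨ solve 6 (λ a′ b c′ d b′ d′ → ((a′ ⊗ b) ⊗ (d ⊗ d′) ⊕ (c′ ⊗ d) ⊗ (b ⊗ b′)) ⊜ ((a′ ⊗ d′ ⊕ c′ ⊗ b′) ⊗ (b ⊗ d))) refl a′ b c′ d b′ d′ ⟩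
      (a′ * d′ + c′ * b′) * (b * d) ∎)

    *ᶠ-cong : ∀ {u u′ v v′} → u ≈ᶠ u′ → v ≈ᶠ v′ → (u *ᶠ v) ≈ᶠ (u′ *ᶠ v′)
    *ᶠ-cong {frac a b _} {frac a′ b′ _} {frac c d _} {frac c′ d′ _} (mk≈ᶠ p) (mk≈ᶠ q) = mk≈ᶠ (begin
      (a * c) * (b′ * d′) ≈⟨ *-interchange a c b′ d′ ⟩
      (a * b′) * (c * d′) ≈⟨ *-cong p q ⟩
      (a′ * b) * (c′ * d) ≈⟨ *-interchange a′ b c′ d ⟩
      (a′ * c′) * (b * d) ∎)
      where *-interchange = CSProps.interchange *-commutativeSemigroup

    -ᶠ-cong : ∀ {u v} → u ≈ᶠ v → (-ᶠ u) ≈ᶠ (-ᶠ v)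
    -ᶠ-cong {frac a b _} {frac c d _} (mk≈ᶠ p) = mk≈ᶠ (begin
      - a * d   ≈⟨ RingProps.-‿distribˡ-* ring a d ⟨
      - (a * d) ≈⟨ -‿cong p ⟩
      - (c * b) ≈⟨ RingProps.-‿distribˡ-* ring c b ⟩
      - c * b   ∎)

    -ᶠ-inverseˡ : ∀ u → ((-ᶠ u) +ᶠ u) ≈ᶠ embed 0#
    -ᶠ-inverseˡ (frac a b _) = mk≈ᶠ (trans (*-identityʳ _)
      (trans (+-congʳ (sym (RingProps.-‿distribˡ-* ring a b)))
      (trans (-‿inverseˡ _) (sym (zeroˡ _)))))

    +ᶠ-comm : ∀ u v → (u +ᶠ v) ≈ᶠ (v +ᶠ u)
    +ᶠ-comm (frac a b _) (frac c d _) = mk≈ᶠ (*-cong (+-comm _ _) (*-comm d b))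

    *ᶠ-comm : ∀ u v → (u *ᶠ v) ≈ᶠ (v *ᶠ u)
    *ᶠ-comm (frac a b _) (frac c d _) = mk≈ᶠ (*-cong (*-comm a c) (*-comm d b))

    +ᶠ-identityˡ : ∀ u → (embed 0# +ᶠ u) ≈ᶠ u
    +ᶠ-identityˡ (frac a b _) = mk≈ᶠ (begin
      (0# * b + a * 1#) * b ≈⟨ *-congʳ (+-cong (zeroˡ b) (*-identityʳ a)) ⟩
      (0# + a) * b          ≈⟨ *-cong (+-identityˡ a) (sym (*-identityˡ b)) ⟩
      a * (1# * b)          ∎)

    *ᶠ-identityˡ : ∀ u → (embed 1# *ᶠ u) ≈ᶠ u
    *ᶠ-identityˡ (frac a b _) = mk≈ᶠ (*-cong (*-identityˡ a) (sym (*-identityˡ b)))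

    +ᶠ-assoc : ∀ u v w → ((u +ᶠ v) +ᶠ w) ≈ᶠ (u +ᶠ (v +ᶠ w))
    +ᶠ-assoc (frac a b _) (frac c d _) (frac e f _) = mk≈ᶠ
      (solve 6 (λ a b c d e f →
        (((a ⊗ d ⊕ c ⊗ b) ⊗ f ⊕ e ⊗ (b ⊗ d)) ⊗ (b ⊗ (d ⊗ f))) ⊜
        ((a ⊗ (d ⊗ f) ⊕ (c ⊗ f ⊕ e ⊗ d) ⊗ b) ⊗ ((b ⊗ d) ⊗ f))) refl a b c d e f)

    *ᶠ-assoc : ∀ u v w → ((u *ᶠ v) *ᶠ w) ≈ᶠ (u *ᶠ (v *ᶠ w))
    *ᶠ-assoc (frac a b _) (frac c d _) (frac e f _) = mk≈ᶠ
      (*-cong (*-assoc a c e) (sym (*-assoc b d f)))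

    *ᶠ-distribˡ : ∀ u v w → (u *ᶠ (v +ᶠ w)) ≈ᶠ ((u *ᶠ v) +ᶠ (u *ᶠ w))
    *ᶠ-distribˡ (frac a b _) (frac c d _) (frac e f _) = mk≈ᶠ
      (solve 6 (λ a b c d e f →
        ((a ⊗ (c ⊗ f ⊕ e ⊗ d)) ⊗ ((b ⊗ d) ⊗ (b ⊗ f))) ⊜
        (((a ⊗ c) ⊗ (b ⊗ f) ⊕ (a ⊗ e) ⊗ (b ⊗ d)) ⊗ (b ⊗ (d ⊗ f)))) refl a b c d e f)

  fracRing : CommutativeRing (c ⊔ ℓ) ℓ
  fracRing = record
    { Carrier = Frac ; _≈_ = _≈ᶠ_ ; _+_ = _+ᶠ_ ; _*_ = _*ᶠ_
    ; -_ = -ᶠ_ ; 0# = embed 0# ; 1# = embed 1#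
    ; isCommutativeRing = record
      { isRing = record
        { +-isAbelianGroup = record
          { isGroup = record
            { isMonoid = record
              { isSemigroup = record
                { isMagma = record
                  { isEquivalence = record
                    { refl = mk≈ᶠ refl ; sym = λ p → mk≈ᶠ (sym (cross p)) ; trans = ≈ᶠ-trans }
                  ; ∙-cong = +ᶠ-cong }
                ; assoc = +ᶠ-assoc }
              ; identity = +ᶠ-identityˡ , λ u → ≈ᶠ-trans (+ᶠ-comm u (embed 0#)) (+ᶠ-identityˡ u) }
            ; inverse = -ᶠ-inverseˡ , λ u → ≈ᶠ-trans (+ᶠ-comm u (-ᶠ u)) (-ᶠ-inverseˡ u)
            ; ⁻¹-cong = -ᶠ-cong }
          ; comm = +ᶠ-comm }
        ; *-cong = *ᶠ-cong
        ; *-assoc = *ᶠ-assoc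
        ; *-identity = *ᶠ-identityˡ , λ u → ≈ᶠ-trans (*ᶠ-comm u (embed 1#)) (*ᶠ-identityˡ u)
        ; distrib = *ᶠ-distribˡ , λ u v w → ≈ᶠ-trans (*ᶠ-comm (v +ᶠ w) u)
            (≈ᶠ-trans (*ᶠ-distribˡ u v w) (+ᶠ-cong (*ᶠ-comm u v) (*ᶠ-comm u w))) }
      ; *-comm = *ᶠ-comm } }

  private
    num≉0 : ∀ {u} → ¬ u ≈ᶠ embed 0# → ¬ num u ≈ 0#
    num≉0 u≉0 p = u≉0 (mk≈ᶠ (trans (*-identityʳ _) (trans p (sym (zeroˡ _)))))

    num≈0 : ∀ {u} → u ≈ᶠ embed 0# → num u ≈ 0#
    num≈0 (mk≈ᶠ p) = trans (sym (*-identityʳ _)) (trans p (zeroˡ _))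

  *ᶠ-noZeroDivisors : ∀ {u v} → ¬ u ≈ᶠ embed 0# → ¬ v ≈ᶠ embed 0# → ¬ (u *ᶠ v) ≈ᶠ embed 0#
  *ᶠ-noZeroDivisors u≉0 v≉0 p = noZeroDivisors (num≉0 u≉0) (num≉0 v≉0) (num≈0 p)

  inverse : ∀ u → ¬ u ≈ᶠ embed 0# → Frac
  inverse u u≉0 = frac (den u) (num u) (num≉0 u≉0)

  inverse-*ᶠ : ∀ u u≉0 → (inverse u u≉0 *ᶠ u) ≈ᶠ embed 1#
  inverse-*ᶠ (frac a b _) _ = mk≈ᶠ (trans (*-identityʳ _) (trans (*-comm b a) (sym (*-identityˡ _))))

  infixl 7 _/_⟨_⟩
  _/_⟨_⟩ : ∀ u v → ¬ v ≈ᶠ embed 0# → Frac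
  u / v ⟨ v≉0 ⟩ = u *ᶠ inverse v v≉0

  embed-injective : ∀ {x y} → embed x ≈ᶠ embed y → x ≈ y
  embed-injective (mk≈ᶠ p) = trans (sym (*-identityʳ _)) (trans p (*-identityʳ _))

  embed-cong : ∀ {x y} → x ≈ y → embed x ≈ᶠ embed y
  embed-cong p = mk≈ᶠ (*-congʳ p)

  embed-+ : ∀ x y → embed (x + y) ≈ᶠ (embed x +ᶠ embed y)
  embed-+ x y = mk≈ᶠ (begin
    (x + y) * (1# * 1#)       ≈⟨ *-cong (+-cong (sym (*-identityʳ x)) (sym (*-identityʳ y))) (*-identityˡ 1#) ⟩
    (x * 1# + y * 1#) * 1#    ∎)

  embed-neg : ∀ x → embed (- x) ≈ᶠ (-ᶠ embed x)
  embed-neg x = mk≈ᶠ refl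

fieldDomain : HeytingField c ℓ₁ ℓ₂ → IntegralDomain c ℓ₁
fieldDomain 𝕂 = record
  { commutativeRing = HeytingCommutativeRing.commutativeRing heytingCommutativeRing
  ; 1≉0 = λ 1≈0 → #-irrefl 1≈0 (invertible⇒# (1# , 1*[1-0]≈1 , trans (*-comm _ _) 1*[1-0]≈1))
  ; noZeroDivisors = λ {x} {y} x≉0 y≉0 xy≈0 → x≉0 (proj₁ (tight x 0#) λ x#0 →
      let (w , w[x-0]≈1 , _) = #⇒invertible x#0
          wx≈1 = trans (*-congˡ (sym (x-0≈x x))) w[x-0]≈1
      in y≉0 (trans (sym (*-identityˡ y)) (trans (*-congʳ (sym wx≈1))
           (trans (*-assoc w x y) (trans (*-congˡ xy≈0) (zeroʳ w))))))
  ; ≈-stable = λ {x} {y} ¬¬p → proj₁ (tight x y) λ x#y → ¬¬p λ x≈y → proj₂ (tight x y) x≈y x#y }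
  where
  open HeytingField 𝕂
  R = HeytingCommutativeRing.commutativeRing heytingCommutativeRing
  x-0≈x : ∀ x → x - 0# ≈ x
  x-0≈x x = trans (+-congˡ (GroupProps.ε⁻¹≈ε (CommutativeRing.+-group R))) (+-identityʳ x)
  1*[1-0]≈1 : 1# * (1# - 0#) ≈ 1#
  1*[1-0]≈1 = trans (*-identityˡ _) (x-0≈x 1#)

module Characteristic (𝕂 : HeytingField c ℓ₁ ℓ₂) where
  open IntegralDomain (fieldDomain 𝕂)
  open MultProps +-monoid using () renaming (_×_ to _×ₙ_)

  HasCharacteristic : ℕ → Set ℓ₁
  HasCharacteristic p = ∀ k → (k ×ₙ 1# ≈ 0#) ⇔ (p ∣ k)

  -- In positive characteristic the prime subfield consists of the natural
  -- multiples of 1.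
  record PrimeSubfield : Set (c ⊔ ℓ₁) where
    field
      value    : Carrier
      multiple : ℕ
      value≈   : value ≈ multiple ×ₙ 1#

module PositiveCharacteristic (𝕂 : HeytingField c ℓ₁ ℓ₂) (p : ℕ)
  (char : Characteristic.HasCharacteristic 𝕂 p) (2<p : 2 < p) where
  open IntegralDomain (fieldDomain 𝕂)
  open Characteristic 𝕂
  open PrimeSubfield
  open MultProps +-monoid using (×-homo-+) renaming (_×_ to _×ₙ_; ×-congˡ to ×ₙ-congˡ)
  open SemiringMultProps semiring using (×1-homo-*)
  open SetoidReasoning setoid

  private
    instance
      p-nonZero : NonZero p
      p-nonZero = ℕ.>-nonZero (ℕ.<-trans (s≤s z≤n) 2<p)

      p-nonTrivial : ℕ.NonTrivial p
      p-nonTrivial = ℕ.n>1⇒nonTrivial (ℕ.<-trans ℕ.≤-refl 2<p)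

    p∣⇒≈0 : ∀ {k} → p ∣ k → k ×ₙ 1# ≈ 0#
    p∣⇒≈0 {k} = Equivalence.from (char k)

    ≈0⇒p∣ : ∀ {k} → k ×ₙ 1# ≈ 0# → p ∣ k
    ≈0⇒p∣ {k} = Equivalence.to (char k)

    *p≈0 : ∀ q → (q ℕ.* p) ×ₙ 1# ≈ 0#
    *p≈0 q = p∣⇒≈0 (divides q ≡.refl)

  p-prime : Prime p
  p-prime = prime λ where
    (composite {d} d<p (divides q p≡q*d)) →
      let d-pos = ℕ.<-trans (s≤s z≤n) (ℕ.nonTrivial⇒n>1 d)
          q-pos = ℕ.n≢0⇒n>0 (λ q≡0 → ℕ.≢-nonZero⁻¹ p (≡.trans p≡q*d (≡.cong (ℕ._* d) q≡0)))
          q<p   = ≡.subst (q <_) (≡.sym p≡q*d)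
                    (ℕ.m<m*n q d {{ℕ.>-nonZero q-pos}} (ℕ.nonTrivial⇒n>1 d))
          small = λ k 0<k k<p k≈0 → ℕ.<⇒≱ k<p (∣⇒≤ {{ℕ.>-nonZero 0<k}} (≈0⇒p∣ {k} k≈0))
      in noZeroDivisors (small q q-pos q<p) (small d d-pos d<p)
           (trans (sym (×1-homo-* q d)) (p∣⇒≈0 (≡.subst (p ∣_) p≡q*d ∣-refl)))

  -2ₚ : PrimeSubfield
  -2ₚ .value    = - (1# + 1#)
  -2ₚ .multiple = p ∸ 2
  -2ₚ .value≈   = sym (GroupProps.inverseˡ-unique +-group _ _ (begin
    (p ∸ 2) ×ₙ 1# + (1# + 1#)  ≈⟨ +-congˡ (+-congˡ (sym (+-identityʳ 1#))) ⟩
    (p ∸ 2) ×ₙ 1# + 2 ×ₙ 1#    ≈⟨ ×-homo-+ 1# (p ∸ 2) 2 ⟨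
    (p ∸ 2 ℕ.+ 2) ×ₙ 1#        ≈⟨ ×ₙ-congˡ (ℕ.m∸n+n≡m (ℕ.<⇒≤ 2<p)) ⟩
    p ×ₙ 1#                    ≈⟨ p∣⇒≈0 ∣-refl ⟩
    0#                         ∎))

  module _ (a : PrimeSubfield) (a≉0 : ¬ value a ≈ 0#) where
    private
      m = multiple a

      p∤m : ¬ p ∣ m
      p∤m p∣m = a≉0 (trans (value≈ a) (p∣⇒≈0 p∣m))

      coprime : Coprime p m
      coprime (d∣p , d∣m) with prime⇒irreducible p-prime d∣p
      ... | inj₁ d≡1    = d≡1
      ... | inj₂ ≡.refl = contradiction d∣m p∤m

      inverse-mod : ∃ λ w → (m ×ₙ 1#) * (w ×ₙ 1#) ≈ 1#
      inverse-mod with coprime-Bézout coprime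
      ... | Bézout.-+ x y eq = y , (begin
        (m ×ₙ 1#) * (y ×ₙ 1#)   ≈⟨ *-comm _ _ ⟩
        (y ×ₙ 1#) * (m ×ₙ 1#)   ≈⟨ ×1-homo-* y m ⟨
        (y ℕ.* m) ×ₙ 1#         ≈⟨ ×ₙ-congˡ eq ⟨
        1# + (x ℕ.* p) ×ₙ 1#    ≈⟨ +-congˡ (*p≈0 x) ⟩
        1# + 0#                 ≈⟨ +-identityʳ 1# ⟩
        1#                      ∎)
      ... | Bézout.+- x y eq = y ℕ.* (y ℕ.* m) , (begin
        (m ×ₙ 1#) * ((y ℕ.* (y ℕ.* m)) ×ₙ 1#)          ≈⟨ *-congˡ (×1-homo-* y (y ℕ.* m)) ⟩
        (m ×ₙ 1#) * ((y ×ₙ 1#) * ((y ℕ.* m) ×ₙ 1#))    ≈⟨ *-assoc _ _ _ ⟨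
        (m ×ₙ 1#) * (y ×ₙ 1#) * ((y ℕ.* m) ×ₙ 1#)      ≈⟨ *-cong (trans (*-comm _ _) (sym (×1-homo-* y m))) refl ⟩
        ((y ℕ.* m) ×ₙ 1#) * ((y ℕ.* m) ×ₙ 1#)          ≈⟨ *-cong ym≈-1 ym≈-1 ⟩
        - 1# * - 1#                                    ≈⟨ RingProps.-1*x≈-x ring (- 1#) ⟩
        - - 1#                                         ≈⟨ GroupProps.⁻¹-involutive +-group 1# ⟩
        1#                                             ∎)
        where
        ym≈-1 : (y ℕ.* m) ×ₙ 1# ≈ - 1#
        ym≈-1 = GroupProps.inverseʳ-unique +-group 1# _ (trans (×ₙ-congˡ eq) (*p≈0 x))

    bar-exists : (b : PrimeSubfield) →
      ∃ λ k → 1 ≤ k × k ≤ p × value a * (k ×ₙ 1#) ≈ value b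
    bar-exists b = normalise (t % p) (m%n<n t p) ≡.refl
      where
      w = proj₁ inverse-mod
      t = w ℕ.* multiple b

      t%p≈t : (t % p) ×ₙ 1# ≈ t ×ₙ 1#
      t%p≈t = begin
        (t % p) ×ₙ 1#                             ≈⟨ +-identityʳ _ ⟨
        (t % p) ×ₙ 1# + 0#                        ≈⟨ +-congˡ (*p≈0 (t / p)) ⟨
        (t % p) ×ₙ 1# + ((t / p) ℕ.* p) ×ₙ 1#     ≈⟨ ×-homo-+ 1# (t % p) _ ⟨
        (t % p ℕ.+ (t / p) ℕ.* p) ×ₙ 1#           ≈⟨ ×ₙ-congˡ (m≡m%n+[m/n]*n t p) ⟨
        t ×ₙ 1#                                   ∎

      at≈b : value a * (t ×ₙ 1#) ≈ value b
      at≈b = begin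
        value a * (t ×ₙ 1#)                            ≈⟨ *-cong (value≈ a) (×1-homo-* w (multiple b)) ⟩
        (m ×ₙ 1#) * ((w ×ₙ 1#) * (multiple b ×ₙ 1#))   ≈⟨ *-assoc _ _ _ ⟨
        (m ×ₙ 1#) * (w ×ₙ 1#) * (multiple b ×ₙ 1#)     ≈⟨ *-congʳ (proj₂ inverse-mod) ⟩
        1# * (multiple b ×ₙ 1#)                        ≈⟨ *-identityˡ _ ⟩
        multiple b ×ₙ 1#                               ≈⟨ value≈ b ⟨
        value b                                        ∎

      normalise : ∀ k → k < p → k ≡ t % p →
        ∃ λ k → 1 ≤ k × k ≤ p × value a * (k ×ₙ 1#) ≈ value b
      normalise zero _ 0≡t%p = p , ℕ.>-nonZero⁻¹ p , ℕ.≤-refl ,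
        trans (*-congˡ (trans (p∣⇒≈0 ∣-refl) (trans (×ₙ-congˡ 0≡t%p) t%p≈t))) at≈b
      normalise (suc k) k<p k≡t%p = suc k , s≤s z≤n , ℕ.<⇒≤ k<p ,
        trans (*-congˡ (trans (×ₙ-congˡ k≡t%p) t%p≈t)) at≈b

    -- The representative b̄ ∈ {1,…,p} of b / a; note that it is p, not 0, for b = 0.
    bar : PrimeSubfield → ℕ
    bar b = proj₁ (bar-exists b)

module MasterFunction (𝕂 : HeytingField c ℓ₁ ℓ₂) (p : ℕ)
  (char : Characteristic.HasCharacteristic 𝕂 p) (2<p : 2 < p) (n r : ℕ)
  (Λ : Fin n → Characteristic.PrimeSubfield 𝕂)
  (a : Characteristic.PrimeSubfield 𝕂)
  (a≉0 : ¬ HeytingField._≈_ 𝕂 (Characteristic.PrimeSubfield.value a) (HeytingField.0# 𝕂)) where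
  open Characteristic 𝕂 using (PrimeSubfield)
  open PrimeSubfield using (value)
  open PositiveCharacteristic 𝕂 p char 2<p using (bar; -2ₚ)

  private
    module K = IntegralDomain (fieldDomain 𝕂)
    module Z = MPoly (fieldDomain 𝕂)

  K[s,x] : IntegralDomain c ℓ₁
  K[s,x] = mPolyDomain (fieldDomain 𝕂) (r ℕ.+ n)

  private
    module A = IntegralDomain K[s,x]

  open FractionField K[s,x] public using (embed; _/_⟨_⟩)
  private
    open module Q = FractionField K[s,x] using (fracRing; embed-cong; embed-+; embed-neg; embed-injective; *ᶠ-noZeroDivisors)

  -- The field K(s,x) of rational functions.
  K⟨s,x⟩ : CommutativeRing (c ⊔ ℓ₁) ℓ₁
  K⟨s,x⟩ = fracRing

  open CommutativeRing K⟨s,x⟩ hiding (zero)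
  open MultProps K.+-monoid using () renaming (_×_ to _×ₙ_)

  ∏ : ∀ {N} → Vector Carrier N → Carrier
  ∏ = RawMonoidDefs.sum *-rawMonoid

  -- The factor f j may use the proof of P j, e.g. to know that a denominator
  -- s l - s j is nonzero.
  ∏[_]_ : ∀ {N} {P : Fin N → Set} → (∀ j → Dec (P j)) → ((j : Fin N) → P j → Carrier) → Carrier
  ∏[_]_ {P = P} P? f = ∏ λ j → term j (P? j)
    where
    term : ∀ j → Dec (P j) → Carrier
    term j (yes Pj) = f j Pj
    term j (no _)   = 1#

  const : K.Carrier → Carrier
  const k = embed (Z.constant (r ℕ.+ n) k)

  s : Fin r → Carrier
  s l = embed (Z.indeterminate (l ↑ˡ n))

  x : Fin n → Carrier
  x m = embed (Z.indeterminate (r ↑ʳ m))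

  aᶜ : Carrier
  aᶜ = const (value a)

  IsPolynomial : Carrier → Set (c ⊔ ℓ₁)
  IsPolynomial u = ∃ λ (P : A.Carrier) → u ≈ embed P

  g : Carrier → PrimeSubfield → Carrier
  g y b = ∏ {bar a a≉0 b ∸ 1} λ i → y + const (suc (toℕ i) ×ₙ value a)

  -- F, like the shifts F(s + a eₗ, x) and F(s, x + a fₘ), is evaluated at points
  -- with coordinates in K(s,x).
  F : (Fin r → Carrier) → (Fin n → Carrier) → Carrier
  F s x =
    (∏ λ m → ∏ λ l → g (s l - x m) (Λ m)) *
    (∏ λ l → ∏[ (λ j → j Fin.<? l) ] λ j _ → (s l - s j) * g (s l - s j + 1#) -2ₚ)

  v : Fin (r ℕ.+ n) → Carrier
  v i = embed (Z.indeterminate i)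

  v-v+k≉0 : ∀ i j → i ≢ j → ∀ k → ¬ v i - v j + const k ≈ 0#
  v-v+k≉0 i j i≢j k p = Z.difference≉0 i j i≢j k (embed-injective (trans
    (trans (embed-+ (zi A.- zj) (Z.constant (r ℕ.+ n) k))
           (+-congʳ {x = const k} (trans (embed-+ zi (A.- zj)) (+-congˡ {x = v i} (embed-neg zj))))) p))
    where
    zi = Z.indeterminate i
    zj = Z.indeterminate j

  const-+ : ∀ k l → const k + const l ≈ const (k K.+ l)
  const-+ k l = sym (trans (embed-cong (Z.constant-+ (r ℕ.+ n) k l)) (embed-+ (Z.constant (r ℕ.+ n) k) (Z.constant (r ℕ.+ n) l)))

  const-neg : ∀ k → - const k ≈ const (K.- k)
  const-neg k = sym (trans (embed-cong (Z.constant-neg (r ℕ.+ n) k)) (embed-neg (Z.constant (r ℕ.+ n) k)))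

  const-0 : 0# ≈ const K.0#
  const-0 = sym (embed-cong (Z.constant-0 (r ℕ.+ n)))

  const-1 : 1# ≈ const K.1#
  const-1 = sym (embed-cong (Z.constant-1 (r ℕ.+ n)))

  private
    s≢x : ∀ l m → l ↑ˡ n ≢ r ↑ʳ m
    s≢x l m eq with ≡.trans (≡.sym (Fin.splitAt-↑ˡ r l n)) (≡.trans (≡.cong (Fin.splitAt r) eq) (Fin.splitAt-↑ʳ r n m))
    ... | ()

    s≢s : ∀ {l j : Fin r} → j ≢ l → l ↑ˡ n ≢ j ↑ˡ n
    s≢s {l} {j} j≢l eq = j≢l (≡.sym (Fin.↑ˡ-injective n l j eq))

    u+k≉0 : ∀ {u k l} → k ≈ l → ¬ u + l ≈ 0# → ¬ u + k ≈ 0#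
    u+k≉0 {u} k≈l u+l≉0 p = u+l≉0 (trans (+-congˡ {x = u} (sym k≈l)) p)

    u+k+l≉0 : ∀ u k l → ¬ u + (k + l) ≈ 0# → ¬ u + k + l ≈ 0#
    u+k+l≉0 u k l u+k+l≉0 p = u+k+l≉0 (trans (sym (+-assoc u k l)) p)

  s-x+a≉0 : ∀ l i → ¬ s l - x i + aᶜ ≈ 0#
  s-x+a≉0 l i = v-v+k≉0 (l ↑ˡ n) (r ↑ʳ i) (s≢x l i) (value a)

  s-x+Λ-a≉0 : ∀ j m → ¬ s j - x m + const (value (Λ m)) - aᶜ ≈ 0#
  s-x+Λ-a≉0 j m = u+k+l≉0 (s j - x m) (const λₘ) (- aᶜ)
    (u+k≉0 {s j - x m} {const λₘ - aᶜ}
      (trans (+-congˡ {x = const λₘ} (const-neg (value a))) (const-+ λₘ (K.- value a)))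
      (v-v+k≉0 (j ↑ˡ n) (r ↑ʳ m) (s≢x j m) (λₘ K.- value a)))
    where λₘ = value (Λ m)

  s-s≉0 : ∀ {l j} → j ≢ l → ¬ s l - s j ≈ 0#
  s-s≉0 {l} {j} j≢l p =
    u+k≉0 {s l - s j} const-0 (v-v+k≉0 (l ↑ˡ n) (j ↑ˡ n) (s≢s {l} {j} j≢l) K.0#)
      (trans (+-identityʳ (s l - s j)) p)

  s-s+1+a≉0 : ∀ {l j} → j ≢ l → ¬ s l - s j + 1# + aᶜ ≈ 0#
  s-s+1+a≉0 {l} {j} j≢l = u+k+l≉0 (s l - s j) 1# aᶜ
    (u+k≉0 {s l - s j} {1# + aᶜ}
      (trans (+-congʳ {x = aᶜ} const-1) (const-+ K.1# (value a)))
      (v-v+k≉0 (l ↑ˡ n) (j ↑ˡ n) (s≢s {l} {j} j≢l) (K.1# K.+ value a)))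

  -- The connection at κ = 1.
  Φ : Fin r → Carrier
  Φ l =
    (∏ λ i → (s l - x i + const (value (Λ i))) / (s l - x i + aᶜ) ⟨ s-x+a≉0 l i ⟩) *
    (∏[ (λ j → ¬? (j Fin.≟ l)) ] λ j j≢l →
      ((s l - s j + aᶜ) * (s l - s j - 1#)) / ((s l - s j) * (s l - s j + 1# + aᶜ))
        ⟨ *ᶠ-noZeroDivisors (s-s≉0 j≢l) (s-s+1+a≉0 j≢l) ⟩)

  Ψ : Fin n → Carrier
  Ψ m = ∏ λ j → (s j - x m) / (s j - x m + const (value (Λ m)) - aᶜ) ⟨ s-x+Λ-a≉0 j m ⟩

  IsMasterFunction : ((Fin r → Carrier) → (Fin n → Carrier) → Carrier) → Set ℓ₁
  IsMasterFunction G = Σ (¬ G s x ≈ 0#) λ G≉0 →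
    (∀ l → Φ l ≈ G (updateAt s l (_+ aᶜ)) x / G s x ⟨ G≉0 ⟩) ×
    (∀ m → Ψ m ≈ G s (updateAt x m (_+ aᶜ)) / G s x ⟨ G≉0 ⟩)

{-# OPTIONS --safe #-}
module Submission where

-- The number b̄ satisfies b̄ a = b, so y ↦ g(y,b) is a product over an arithmetic progression
-- with step a and telescopes to g(y+a,b) (y+a) = (y+b) g(y,b).  Shifting s_l or x_m by a
-- changes only the factors of F containing that variable, and each of their quotients is read
-- off from this relation: the relation at y = s_l - x_m gives the first product in Φ_l, the one
-- at y = s_l - x_m - a gives Ψ_m.  A pair {j,l} contributes a single factor of F, in
-- s_l - s_j if j < l and in s_j - s_l if l < j; both cases have the same quotient because the
-- two sign changes in numerator and denominator cancel.

open import Defs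
open import Level using (Level; _⊔_)
open import Algebra.Apartness.Bundles using (HeytingField)
open import Algebra.Bundles using (CommutativeMonoid)
open import Data.Fin using (Fin; zero; suc; toℕ; punchIn; _<?_; _≟_; _↑ˡ_; _↑ʳ_; splitAt)
import Data.Fin.Properties as Fin
open import Data.Nat using (ℕ; zero; suc; _<_; _≤_; _∸_)
import Data.Nat.Base as ℕ
import Data.Nat.Properties as ℕ
open import Data.Product using (_×_; _,_)
open import Data.Vec.Functional using (Vector; updateAt)
open import Data.Vec.Functional.Properties using (updateAt-updates; updateAt-minimal)
open import Function.Base using (_∘_)
open import Relation.Binary.Definitions using (tri<; tri≈; tri>)
open import Relation.Binary.PropositionalEquality as ≡ using (_≡_; _≢_)
open import Relation.Nullary using (¬_; Dec; yes; no; contradiction; ¬?)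
import Algebra.Properties.AbelianGroup as AbelianGroupProps
import Algebra.Properties.CommutativeMonoid.Sum as CommutativeMonoidSum
import Algebra.Properties.CommutativeSemigroup as CommutativeSemigroupProps
import Algebra.Properties.Ring as RingProps
import Algebra.Solver.CommutativeMonoid as CommutativeMonoidSolver
import Algebra.Properties.Monoid.Mult as MonoidMult
import Algebra.Properties.Semiring.Mult as SemiringMult
import Relation.Binary.Reasoning.Setoid as SetoidReasoning

private
  variable
    c ℓ : Level

-- Finite products, conditional factors and telescoping in a commutative monoid.

module Products (M : CommutativeMonoid c ℓ) where
  open CommutativeMonoid M
  open CommutativeMonoidSum M public
    using () renaming (sum to ∏; sum-cong-≋ to ∏-cong; sum-remove to ∏-remove; ∑-distrib-+ to ∏-distrib)
  open CommutativeMonoidSolver M using (solve; _⊜_; _⊕_)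
  open SetoidReasoning setoid

  -- The decision is an explicit argument, so that lemmas can split on it; the factor may depend on
  -- the proof because denominators do.
  guarded : ∀ {p} {P : Set p} → Dec P → (P → Carrier) → Carrier
  guarded (yes Pj) f = f Pj
  guarded (no _)   f = ε

  -- The proof stored in the decision need not be the given one, so `Q` is required at every proof
  -- of `P`.
  guarded-yes : ∀ {p q} {P : Set p} (P? : Dec P) {f} (Q : Carrier → Set q) →
    P → (∀ Pj → Q (f Pj)) → Q (guarded P? f)
  guarded-yes (yes Pj) Q _  q = q Pj
  guarded-yes (no ¬Pj) Q Pj q = contradiction Pj ¬Pj

  guarded-no : ∀ {p} {P : Set p} (P? : Dec P) {f} → ¬ P → guarded P? f ≈ ε
  guarded-no (yes Pj) ¬Pj = contradiction Pj ¬Pj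
  guarded-no (no _)   _   = refl

  guarded-cong : ∀ {p} {P : Set p} (P? : Dec P) {f g} →
    (∀ Pj → f Pj ≈ g Pj) → guarded P? f ≈ guarded P? g
  guarded-cong (yes Pj) f≈g = f≈g Pj
  guarded-cong (no _)   _   = refl

  guarded-all : ∀ {p q} {P : Set p} (P? : Dec P) {f} (Q : Carrier → Set q) →
    Q ε → (∀ Pj → Q (f Pj)) → Q (guarded P? f)
  guarded-all (yes Pj) Q _  q = q Pj
  guarded-all (no _)   Q qε _ = qε

  ∏-all : ∀ {q N} (Q : Carrier → Set q) → Q ε → (∀ {x y} → Q x → Q y → Q (x ∙ y)) →
    {f : Vector Carrier N} → (∀ i → Q (f i)) → Q (∏ f)
  ∏-all {N = zero}  Q qε _∙q_ q = qε
  ∏-all {N = suc N} Q qε _∙q_ q = q zero ∙q ∏-all Q qε _∙q_ (q ∘ suc)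

  ∏-quotient : ∀ {N} (u v w : Vector Carrier N) → (∀ i → u i ∙ v i ≈ w i) → ∏ u ∙ ∏ v ≈ ∏ w
  ∏-quotient u v w uv≈w = trans (sym (∏-distrib u v)) (∏-cong uv≈w)

  ∏-update-quotient : ∀ {N} (l : Fin N) u (v w : Vector Carrier N) →
    u ∙ v l ≈ w l → (∀ j → j ≢ l → v j ≈ w j) → u ∙ ∏ v ≈ ∏ w
  ∏-update-quotient {suc N} l u v w uv≈w v≈w = begin
    u ∙ ∏ v                            ≈⟨ ∙-congˡ (∏-remove v) ⟩
    u ∙ (v l ∙ ∏ (v ∘ punchIn l))      ≈⟨ assoc _ _ _ ⟨
    u ∙ v l ∙ ∏ (v ∘ punchIn l)        ≈⟨ ∙-cong uv≈w (∏-cong (λ j → v≈w _ (Fin.punchInᵢ≢i l j))) ⟩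
    w l ∙ ∏ (w ∘ punchIn l)            ≈⟨ ∏-remove w ⟨
    ∏ w                                ∎

  -- A square array splits into the diagonal entry at `l`, the rest of row and column `l` paired
  -- index by index, and the complementary minor.
  ∏∏-cross : ∀ {N} (l : Fin (suc N)) (H : Fin (suc N) → Fin (suc N) → Carrier) →
    ∏ (λ k → ∏ (H k)) ≈
      H l l ∙ ∏ (λ j → H l (punchIn l j) ∙ H (punchIn l j) l)
        ∙ ∏ (λ k → ∏ (λ j → H (punchIn l k) (punchIn l j)))
  ∏∏-cross l H = begin
    ∏ (λ k → ∏ (H k))                            ≈⟨ ∏-remove (λ k → ∏ (H k)) ⟩
    ∏ (H l) ∙ ∏ (λ k → ∏ (H (punchIn l k)))      ≈⟨ ∙-cong (∏-remove (H l)) (∏-cong λ k → ∏-remove (H (punchIn l k))) ⟩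
    H l l ∙ ∏ row ∙ ∏ (λ k → column k ∙ ∏ (rest k)) ≈⟨ ∙-congˡ (∏-distrib column (λ k → ∏ (rest k))) ⟩
    H l l ∙ ∏ row ∙ (∏ column ∙ ∏ (λ k → ∏ (rest k)))
      ≈⟨ solve 4 (λ h x y z → ((h ⊕ x) ⊕ (y ⊕ z)) ⊜ ((h ⊕ (x ⊕ y)) ⊕ z)) refl (H l l) (∏ row) (∏ column) _ ⟩
    H l l ∙ (∏ row ∙ ∏ column) ∙ ∏ (λ k → ∏ (rest k)) ≈⟨ ∙-congʳ (∙-congˡ (∏-distrib row column)) ⟨
    H l l ∙ ∏ (λ j → row j ∙ column j) ∙ ∏ (λ k → ∏ (rest k)) ∎
    where
    row column : Vector Carrier _
    row j    = H l (punchIn l j)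
    column k = H (punchIn l k) l
    rest : Fin _ → Vector Carrier _
    rest k j = H (punchIn l k) (punchIn l j)

  -- Moving the `l`-th variable affects row and column `l` only. The entries `H l j` and `H j l` are
  -- compared through their product, since the order of `j` and `l` decides which of them carries
  -- the factor of the pair.
  ∏∏-cross-quotient : ∀ {N} (l : Fin N) (u : Vector Carrier N) (H H′ : Fin N → Fin N → Carrier) →
    u l ∙ H l l ≈ H′ l l →
    (∀ j → j ≢ l → u j ∙ (H l j ∙ H j l) ≈ H′ l j ∙ H′ j l) →
    (∀ k j → k ≢ l → j ≢ l → H k j ≈ H′ k j) →
    ∏ u ∙ ∏ (λ k → ∏ (H k)) ≈ ∏ (λ k → ∏ (H′ k))
  ∏∏-cross-quotient {suc N} l u H H′ diagonal cross rest = begin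
    ∏ u ∙ ∏ (λ k → ∏ (H k))
      ≈⟨ ∙-cong (∏-remove u) (∏∏-cross l H) ⟩
    u l ∙ ∏ (u ∘ punchIn l) ∙ (H l l ∙ ∏ (arms H) ∙ R)
      ≈⟨ solve 5 (λ a b c d e → ((a ⊕ b) ⊕ ((c ⊕ d) ⊕ e)) ⊜ (((a ⊕ c) ⊕ (b ⊕ d)) ⊕ e)) refl (u l) _ (H l l) (∏ (arms H)) R ⟩
    u l ∙ H l l ∙ (∏ (u ∘ punchIn l) ∙ ∏ (arms H)) ∙ R
      ≈⟨ ∙-cong
           (∙-cong diagonal (∏-quotient (u ∘ punchIn l) (arms H) (arms H′) λ j → cross _ (≢l j)))
           (∏-cong λ k → ∏-cong λ j → rest _ _ (≢l k) (≢l j)) ⟩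
    H′ l l ∙ ∏ (arms H′) ∙ ∏ (λ k → ∏ (λ j → H′ (punchIn l k) (punchIn l j)))
      ≈⟨ ∏∏-cross l H′ ⟨
    ∏ (λ k → ∏ (H′ k)) ∎
    where
    ≢l = Fin.punchInᵢ≢i l
    R = ∏ (λ k → ∏ (λ j → H (punchIn l k) (punchIn l j)))
    arms : (Fin (suc N) → Fin (suc N) → Carrier) → Vector Carrier N
    arms H j = H l (punchIn l j) ∙ H (punchIn l j) l

  -- Both sides are the product of `t 0`, ..., `t N`; this is telescoping without division.
  ∏-telescope : ∀ N (t : ℕ → Carrier) →
    ∏ {N} (λ i → t (suc (toℕ i))) ∙ t 0 ≈ t N ∙ ∏ {N} (λ i → t (toℕ i))
  ∏-telescope zero    t = comm _ _
  ∏-telescope (suc N) t = begin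
    t 1 ∙ ∏ {N} (λ i → t (suc (suc (toℕ i)))) ∙ t 0 ≈⟨ ∙-congʳ (trans (comm _ _) (∏-telescope N (t ∘ suc))) ⟩
    t (suc N) ∙ ∏ {N} (λ i → t (suc (toℕ i))) ∙ t 0 ≈⟨ assoc _ _ _ ⟩
    t (suc N) ∙ (∏ {N} (λ i → t (suc (toℕ i))) ∙ t 0) ≈⟨ ∙-congˡ (comm _ _) ⟩
    t (suc N) ∙ (t 0 ∙ ∏ {N} (λ i → t (suc (toℕ i)))) ∎

-- First-order difference equations over an integral domain.

module DifferenceEquation (D : IntegralDomain c ℓ) where
  open IntegralDomain D hiding (zero)
  open Products *-commutativeMonoid
  open AbelianGroupProps +-abelianGroup
    using (⁻¹-anti-homo‿-; ⁻¹-∙-comm; //-rightDividesˡ; //-rightDividesʳ; ⁻¹-involutive)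
  open RingProps ring using (-‿distribˡ-*; -‿distribʳ-*)
  open CommutativeSemigroupProps +-commutativeSemigroup using (xy∙z≈xz∙y)
  open CommutativeMonoidSolver *-commutativeMonoid using (solve; _⊜_; _⊕_)
  open SetoidReasoning setoid

  -- The equation G(y+a)/G(y) = (y+b)/(y+a) with denominators cleared; over the complex numbers the
  -- Gamma quotient Γ((y+b)/a)/Γ((y+a)/a) satisfies it.
  record ShiftSolution (a b : Carrier) (G : Carrier → Carrier) : Set (c ⊔ ℓ) where
    field
      cong  : ∀ {y z} → y ≈ z → G y ≈ G z
      shift : ∀ y → G (y + a) * (y + a) ≈ (y + b) * G y

  -- Here `k i` plays the role of i times `a`. Replacing y by y + a moves every factor to the next
  -- one, so only the end terms `y + k 1` and `y + k (suc N)` survive, which are y + a and y + b.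
  progression-shiftSolution : ∀ a (k : ℕ → Carrier) → k 1 ≈ a → (∀ i → k (suc i) ≈ a + k i) →
    ∀ N b → k (suc N) ≈ b → ShiftSolution a b λ y → ∏ {N} (λ i → y + k (suc (toℕ i)))
  progression-shiftSolution a k k₁≈a step N b k≈b = record
    { cong = λ y≈z → ∏-cong {N} λ i → +-congʳ y≈z
    ; shift = λ y → begin
        ∏ {N} (λ i → y + a + k (suc (toℕ i))) * (y + a)
          ≈⟨ *-cong (∏-cong {N} λ i → trans (+-assoc y a _) (+-congˡ (sym (step _)))) (+-congˡ (sym k₁≈a)) ⟩
        ∏ {N} (λ i → y + k (suc (suc (toℕ i)))) * (y + k 1)
          ≈⟨ ∏-telescope N (λ i → y + k (suc i)) ⟩
        (y + k (suc N)) * ∏ {N} (λ i → y + k (suc (toℕ i)))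
          ≈⟨ *-congʳ (+-congˡ k≈b) ⟩
        (y + b) * ∏ {N} (λ i → y + k (suc (toℕ i))) ∎ }

  -- The solution value passes from `f` to `f′` with quotient e/d while a further factor passes from
  -- `t` to `t′`. After multiplication by `d` both sides equal t′ e f.
  quotient-step : ∀ {d e f f′ t t′ w} → ¬ d ≈ 0# → w * (t * d) ≈ t′ * e → f′ * d ≈ e * f →
    w * (t * f) ≈ t′ * f′
  quotient-step {d} {e} {f} {f′} {t} {t′} {w} d≉0 wtd≈t′e f′d≈ef = *-cancelˡ d≉0 (begin
    d * (w * (t * f))  ≈⟨ solve 4 (λ d w t f → (d ⊕ (w ⊕ (t ⊕ f))) ⊜ ((w ⊕ (t ⊕ d)) ⊕ f)) refl d w t f ⟩
    w * (t * d) * f    ≈⟨ *-congʳ wtd≈t′e ⟩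
    t′ * e * f         ≈⟨ *-assoc _ _ _ ⟩
    t′ * (e * f)       ≈⟨ *-congˡ f′d≈ef ⟨
    t′ * (f′ * d)      ≈⟨ solve 3 (λ t f d → (t ⊕ (f ⊕ d)) ⊜ (d ⊕ (t ⊕ f))) refl t′ f′ d ⟩
    d * (t′ * f′)      ∎)

  quotient-step₁ : ∀ {d e f f′ w} → ¬ d ≈ 0# → w * d ≈ e → f′ * d ≈ e * f → w * f ≈ f′
  quotient-step₁ {d} {e} {f} {f′} {w} d≉0 wd≈e f′d≈ef = begin
    w * f          ≈⟨ *-congˡ (*-identityˡ f) ⟨
    w * (1# * f)   ≈⟨ quotient-step d≉0 (trans (*-congˡ (*-identityˡ d)) (trans wd≈e (sym (*-identityˡ e)))) f′d≈ef ⟩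
    1# * f′        ≈⟨ *-identityˡ f′ ⟩
    f′             ∎

  module _ {a b : Carrier} {G : Carrier → Carrier} (sol : ShiftSolution a b G) where
    open ShiftSolution sol

    shift-up : ∀ {y y′ u} → ¬ y + a ≈ 0# → u * (y + a) ≈ y + b → y′ ≈ y + a → u * G y ≈ G y′
    shift-up {y} y+a≉0 u≈ y′≈ = trans (quotient-step₁ y+a≉0 u≈ (shift y)) (cong (sym y′≈))

    -- The relation is used at the new point `y′`, where its factor y′ + b is the denominator y + b
    -- - a.
    shift-down : ∀ {y y′ u} → ¬ y + b - a ≈ 0# → u * (y + b - a) ≈ y → y ≈ y′ + a → u * G y ≈ G y′
    shift-down {y} {y′} d≉0 u≈ y≈ = quotient-step₁ d≉0 u≈ (begin
      G y′ * (y + b - a)   ≈⟨ *-congˡ (xy∙z≈xz∙y y b (- a)) ⟩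
      G y′ * (y - a + b)   ≈⟨ *-congˡ (+-congʳ (+-congʳ y≈)) ⟩
      G y′ * (y′ + a - a + b) ≈⟨ *-congˡ (+-congʳ (//-rightDividesʳ a y′)) ⟩
      G y′ * (y′ + b)      ≈⟨ *-comm _ _ ⟩
      (y′ + b) * G y′      ≈⟨ shift y′ ⟨
      G (y′ + a) * (y′ + a) ≈⟨ *-cong (cong (sym y≈)) (sym y≈) ⟩
      G y * y              ≈⟨ *-comm _ _ ⟩
      y * G y              ∎)

  module _ {a : Carrier} {E : Carrier → Carrier} (sol : ShiftSolution a (- (1# + 1#)) E) where
    open ShiftSolution sol

    pair : Carrier → Carrier
    pair y = y * E (y + 1#)

    pair-cong : ∀ {y z} → y ≈ z → pair y ≈ pair z
    pair-cong y≈z = *-cong y≈z (cong (+-congʳ y≈z))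

    private
      y+1-2≈y-1 : ∀ y → y + 1# - (1# + 1#) ≈ y - 1#
      y+1-2≈y-1 y = begin
        y + 1# - (1# + 1#)      ≈⟨ +-assoc _ _ _ ⟩
        y + (1# - (1# + 1#))    ≈⟨ +-congˡ (+-congˡ (⁻¹-∙-comm 1# 1#)) ⟨
        y + (1# + (- 1# - 1#))  ≈⟨ +-congˡ (+-assoc _ _ _) ⟨
        y + (1# - 1# - 1#)      ≈⟨ +-congˡ (+-congʳ (-‿inverseʳ 1#)) ⟩
        y + (0# - 1#)           ≈⟨ +-congˡ (+-identityˡ _) ⟩
        y - 1#                  ∎

    -- The linear factor contributes (y+a)/y. The relation for `E` at y + 1 with b = -2 contributes
    -- (y-1)/(y+1+a).
    pair-up : ∀ {y y′ w} → ¬ y + 1# + a ≈ 0# →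
      w * (y * (y + 1# + a)) ≈ (y + a) * (y - 1#) → y′ ≈ y + a → w * pair y ≈ pair y′
    pair-up {y} {y′} {w} d≉0 w≈ y′≈ = trans
      (quotient-step d≉0 w≈ (begin
        E (y + a + 1#) * (y + 1# + a)  ≈⟨ *-congʳ (cong (xy∙z≈xz∙y y a 1#)) ⟩
        E (y + 1# + a) * (y + 1# + a)  ≈⟨ shift (y + 1#) ⟩
        (y + 1# - (1# + 1#)) * E (y + 1#) ≈⟨ *-congʳ (y+1-2≈y-1 y) ⟩
        (y - 1#) * E (y + 1#)          ∎))
      (pair-cong (sym y′≈))

    -- The argument z = -y now drops by `a`, so the relation for `E` is used at z′ + 1. Its factors
    -- are z′ - 1 = -(y+1+a) and z + 1 = -(y-1), and the linear factor gives z′/z = (y+a)/y; hence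
    -- `w` is the same as in `pair-up`.
    pair-down : ∀ {y z z′ w} → ¬ y + 1# + a ≈ 0# →
      w * (y * (y + 1# + a)) ≈ (y + a) * (y - 1#) → z ≈ - y → z′ ≈ - (y + a) → w * pair z ≈ pair z′
    pair-down {y} {z} {z′} {w} d≉0 w≈ z≈ z′≈ = quotient-step d≉0
      (begin
        w * (z * d)                     ≈⟨ *-congˡ (*-congʳ z≈) ⟩
        w * (- y * d)                   ≈⟨ *-congˡ (-‿distribˡ-* y d) ⟨
        w * - (y * d)                   ≈⟨ -‿distribʳ-* w (y * d) ⟨
        - (w * (y * d))                 ≈⟨ -‿cong w≈ ⟩
        - ((y + a) * (y - 1#))          ≈⟨ -‿distribˡ-* (y + a) (y - 1#) ⟩
        - (y + a) * (y - 1#)            ≈⟨ *-congʳ z′≈ ⟨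
        z′ * (y - 1#)                   ∎)
      (begin
        E (z′ + 1#) * d                 ≈⟨ *-comm _ _ ⟩
        d * E (z′ + 1#)                 ≈⟨ *-congʳ (⁻¹-involutive d) ⟨
        - - d * E (z′ + 1#)             ≈⟨ *-congʳ (-‿cong -d≈) ⟩
        - (z′ + 1# - (1# + 1#)) * E (z′ + 1#)   ≈⟨ -‿distribˡ-* _ _ ⟨
        - ((z′ + 1# - (1# + 1#)) * E (z′ + 1#)) ≈⟨ -‿cong (shift (z′ + 1#)) ⟨
        - (E (z′ + 1# + a) * (z′ + 1# + a))     ≈⟨ -‿cong (*-cong (cong z′+1+a≈) z′+1+a≈) ⟩
        - (E (z + 1#) * (z + 1#))       ≈⟨ -‿cong (*-comm _ _) ⟩
        - ((z + 1#) * E (z + 1#))       ≈⟨ -‿distribˡ-* _ _ ⟩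
        - (z + 1#) * E (z + 1#)         ≈⟨ *-congʳ (⁻¹-∙-comm z 1#) ⟨
        (- z - 1#) * E (z + 1#)         ≈⟨ *-congʳ (+-congʳ (trans (-‿cong z≈) (⁻¹-involutive y))) ⟩
        (y - 1#) * E (z + 1#)           ∎)
      where
      d = y + 1# + a

      -d≈ : - d ≈ z′ + 1# - (1# + 1#)
      -d≈ = begin
        - (y + 1# + a)         ≈⟨ -‿cong (xy∙z≈xz∙y y 1# a) ⟩
        - (y + a + 1#)         ≈⟨ ⁻¹-∙-comm (y + a) 1# ⟨
        - (y + a) - 1#         ≈⟨ +-congʳ z′≈ ⟨
        z′ - 1#                ≈⟨ y+1-2≈y-1 z′ ⟨
        z′ + 1# - (1# + 1#)    ∎

      z′+1+a≈ : z′ + 1# + a ≈ z + 1#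
      z′+1+a≈ = begin
        z′ + 1# + a            ≈⟨ xy∙z≈xz∙y z′ 1# a ⟩
        z′ + a + 1#            ≈⟨ +-congʳ (+-congʳ (trans z′≈ (sym (⁻¹-∙-comm y a)))) ⟩
        - y - a + a + 1#       ≈⟨ +-congʳ (//-rightDividesˡ a (- y)) ⟩
        - y + 1#               ≈⟨ +-congʳ z≈ ⟨
        z + 1#                 ∎

  [u+a]-v≈[u-v]+a : ∀ u v a → u + a - v ≈ u - v + a
  [u+a]-v≈[u-v]+a u v a = xy∙z≈xz∙y u a (- v)

  u-v≈[u-[v+a]]+a : ∀ u v a → u - v ≈ u - (v + a) + a
  u-v≈[u-[v+a]]+a u v a = begin
    u - v             ≈⟨ //-rightDividesˡ a (u - v) ⟨
    u - v - a + a     ≈⟨ +-congʳ (trans (+-assoc u (- v) (- a)) (+-congˡ (⁻¹-∙-comm v a))) ⟩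
    u - (v + a) + a   ∎

  -- The master function built from arbitrary solutions of the difference equations.

  module Master (n r : ℕ) (a : Carrier) (Λ : Fin n → Carrier)
    (G : Fin n → Carrier → Carrier) (G-sol : ∀ m → ShiftSolution a (Λ m) (G m))
    (E : Carrier → Carrier) (E-sol : ShiftSolution a (- (1# + 1#)) E) where

    -- The triangular product is padded with 1 to a full square array, so that `∏∏-cross-quotient`
    -- applies.
    pairs : Vector Carrier r → Fin r → Fin r → Carrier
    pairs s k j = guarded (j <? k) λ _ → pair E-sol (s k - s j)

    master : Vector Carrier r → Vector Carrier n → Carrier
    master s x = ∏ (λ m → ∏ λ l → G m (s l - x m)) * ∏ λ k → ∏ (pairs s k)

    -- One of the two entries is always 1. The other is handled by `pair-up` if j < l and by
    -- `pair-down` if l < j, with the quotient written in `s l - s j` in both cases.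
    pairs-cross-quotient : ∀ (s : Vector Carrier r) l j {w} → j ≢ l →
      ¬ s l - s j + 1# + a ≈ 0# →
      w * ((s l - s j) * (s l - s j + 1# + a)) ≈ (s l - s j + a) * (s l - s j - 1#) →
      let s′ = updateAt s l (_+ a) in w * (pairs s l j * pairs s j l) ≈ pairs s′ l j * pairs s′ j l
    pairs-cross-quotient s l j {w} j≢l d≉0 w≈ with Fin.<-cmp j l
    ... | tri< j<l _ l≮j = cross
      where
      s′ = updateAt s l (_+ a)
      cross : w * (pairs s l j * pairs s j l) ≈ pairs s′ l j * pairs s′ j l
      cross = begin
        w * (pairs s l j * pairs s j l)       ≈⟨ *-congˡ (off-diagonal s) ⟩
        w * pair E-sol (s l - s j)            ≈⟨ pair-up E-sol d≉0 w≈ s′-s′≈ ⟩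
        pair E-sol (s′ l - s′ j)              ≈⟨ off-diagonal s′ ⟨
        pairs s′ l j * pairs s′ j l           ∎
        where
        s′-s′≈ : s′ l - s′ j ≈ s l - s j + a
        s′-s′≈ = trans
          (+-cong (reflexive (updateAt-updates l s)) (-‿cong (reflexive (updateAt-minimal j l s j≢l))))
          ([u+a]-v≈[u-v]+a _ _ _)
        off-diagonal : ∀ s → pairs s l j * pairs s j l ≈ pair E-sol (s l - s j)
        off-diagonal s = trans
          (*-cong (guarded-yes (j <? l) (_≈ pair E-sol (s l - s j)) j<l λ _ → refl) (guarded-no (l <? j) l≮j))
          (*-identityʳ _)
    ... | tri≈ _ j≡l _ = contradiction j≡l j≢l
    ... | tri> j≮l _ l<j = cross
      where
      s′ = updateAt s l (_+ a)
      cross : w * (pairs s l j * pairs s j l) ≈ pairs s′ l j * pairs s′ j l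
      cross = begin
        w * (pairs s l j * pairs s j l)       ≈⟨ *-congˡ (off-diagonal s) ⟩
        w * pair E-sol (s j - s l)            ≈⟨ pair-down E-sol d≉0 w≈ (sym (⁻¹-anti-homo‿- _ _)) s′-s′≈ ⟩
        pair E-sol (s′ j - s′ l)              ≈⟨ off-diagonal s′ ⟨
        pairs s′ l j * pairs s′ j l           ∎
        where
        s′-s′≈ : s′ j - s′ l ≈ - (s l - s j + a)
        s′-s′≈ = begin
          s′ j - s′ l
            ≈⟨ +-cong (reflexive (updateAt-minimal j l s j≢l)) (-‿cong (reflexive (updateAt-updates l s))) ⟩
          s j - (s l + a)      ≈⟨ ⁻¹-anti-homo‿- _ _ ⟨
          - (s l + a - s j)    ≈⟨ -‿cong ([u+a]-v≈[u-v]+a _ _ _) ⟩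
          - (s l - s j + a)    ∎
        off-diagonal : ∀ s → pairs s l j * pairs s j l ≈ pair E-sol (s j - s l)
        off-diagonal s = trans
          (*-cong (guarded-no (j <? l) j≮l) (guarded-yes (l <? j) (_≈ pair E-sol (s j - s l)) l<j λ _ → refl))
          (*-identityˡ _)

    master-shift-s : ∀ (s : Vector Carrier r) (x : Vector Carrier n) l
      (u : Vector Carrier n) (w : Vector Carrier r) →
      (∀ m → ¬ s l - x m + a ≈ 0#) → (∀ m → u m * (s l - x m + a) ≈ s l - x m + Λ m) →
      (∀ {j} → j ≢ l → ¬ s l - s j + 1# + a ≈ 0#) →
      (∀ {j} → j ≢ l → w j * ((s l - s j) * (s l - s j + 1# + a)) ≈ (s l - s j + a) * (s l - s j - 1#)) →
      w l ≈ 1# → ∏ u * ∏ w * master s x ≈ master (updateAt s l (_+ a)) x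
    master-shift-s s x l u w s-x≉0 u≈ s-s≉0 w≈ wₗ≈1 = begin
      ∏ u * ∏ w * master s x
        ≈⟨ CommutativeSemigroupProps.interchange *-commutativeSemigroup _ _ _ _ ⟩
      ∏ u * ∏ (λ m → ∏ λ k → G m (s k - x m)) * (∏ w * ∏ λ k → ∏ (pairs s k))
        ≈⟨ *-cong
             -- For each `m` only the factor at index `l` moves, and it moves up by `a`.
             (∏-quotient u _ _ λ m → ∏-update-quotient l (u m) _ _
               (shift-up (G-sol m) (s-x≉0 m) (u≈ m)
                 (trans (+-congʳ (reflexive (updateAt-updates l s))) ([u+a]-v≈[u-v]+a _ _ _)))
               λ k k≢l → ShiftSolution.cong (G-sol m) (+-congʳ (fixed k≢l)))
             (∏∏-cross-quotient l w (pairs s) (pairs s′)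
               -- On the diagonal everything is the default value 1, including `w l`.
               (trans (*-cong wₗ≈1 (diagonal s)) (trans (*-identityˡ 1#) (sym (diagonal s′))))
               (λ j j≢l → pairs-cross-quotient s l j j≢l (s-s≉0 j≢l) (w≈ j≢l))
               λ k j k≢l j≢l → guarded-cong (j <? k) λ _ →
                 pair-cong E-sol (+-cong (fixed k≢l) (-‿cong (fixed j≢l)))) ⟩
      master s′ x ∎
      where
      s′ = updateAt s l (_+ a)
      fixed : ∀ {k} → k ≢ l → s k ≈ s′ k
      fixed {k} k≢l = reflexive (≡.sym (updateAt-minimal k l s k≢l))
      diagonal : ∀ s → pairs s l l ≈ 1#
      diagonal s = guarded-no (l <? l) (Fin.<-irrefl ≡.refl)

    master-shift-x : ∀ (s : Vector Carrier r) (x : Vector Carrier n) m (u : Vector Carrier r) →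
      (∀ j → ¬ s j - x m + Λ m - a ≈ 0#) → (∀ j → u j * (s j - x m + Λ m - a) ≈ s j - x m) →
      ∏ u * master s x ≈ master s (updateAt x m (_+ a))
    master-shift-x s x m u d≉0 u≈ = begin
      ∏ u * master s x
        ≈⟨ *-assoc _ _ _ ⟨
      ∏ u * ∏ (λ i → ∏ λ j → G i (s j - x i)) * ∏ (λ k → ∏ (pairs s k))
        -- The whole row `m` counts as the single changing factor, with quotient `∏ u`. Raising
        -- `x m` lowers each `s j - x m` by `a`, hence `shift-down`.
        ≈⟨ *-congʳ (∏-update-quotient m (∏ u) _ _
             (∏-quotient u _ _ λ j → shift-down (G-sol m) (d≉0 j) (u≈ j)
               (trans (u-v≈[u-[v+a]]+a _ _ a) (+-congʳ (+-congˡ (-‿cong (reflexive (≡.sym (updateAt-updates m x))))))))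
             λ i i≢m → ∏-cong {r} λ j → ShiftSolution.cong (G-sol i)
               (+-congˡ (-‿cong (reflexive (≡.sym (updateAt-minimal i m x i≢m)))))) ⟩
      master s (updateAt x m (_+ a)) ∎

-- The fraction field as an integral domain, and its division.

module FractionFieldProperties (D : IntegralDomain c ℓ) where
  open FractionField D
  private
    module D = IntegralDomain D

  fracDomain : IntegralDomain (c ⊔ ℓ) ℓ
  fracDomain = record
    { commutativeRing = fracRing
    ; 1≉0 = λ 1≈0 → D.1≉0 (embed-injective 1≈0)
    ; noZeroDivisors = *ᶠ-noZeroDivisors
    ; ≈-stable = λ ¬¬p → mk≈ᶠ (D.≈-stable λ ¬q → ¬¬p λ p → ¬q (cross p)) }

  open IntegralDomain fracDomain

  embed-* : ∀ x y → embed (x D.* y) ≈ embed x * embed y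
  embed-* x y = mk≈ᶠ (D.*-congˡ (D.*-identityˡ D.1#))

  /-*-cancel : ∀ u v v≉0 → (u / v ⟨ v≉0 ⟩) * v ≈ u
  /-*-cancel u v v≉0 = trans (*-assoc u (inverse v v≉0) v)
    (trans (*-congˡ {x = u} (inverse-*ᶠ v v≉0)) (*-identityʳ u))

  *⇒/ : ∀ u v w v≉0 → u * v ≈ w → u ≈ w / v ⟨ v≉0 ⟩
  *⇒/ u v w v≉0 uv≈w = *-cancelˡ {v} {u} {w / v ⟨ v≉0 ⟩} v≉0
    (trans (*-comm v u) (trans uv≈w (trans (sym (/-*-cancel w v v≉0)) (*-comm (w / v ⟨ v≉0 ⟩) v))))

-- Application to the rational functions in s and x.

module MasterFunctionProperties {c ℓ₁ ℓ₂ : Level} (𝕂 : HeytingField c ℓ₁ ℓ₂) (p : ℕ)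
  (char : Characteristic.HasCharacteristic 𝕂 p) (2<p : 2 < p) (n r : ℕ)
  (Λ : Fin n → Characteristic.PrimeSubfield 𝕂)
  (a : Characteristic.PrimeSubfield 𝕂)
  (a≉0 : ¬ HeytingField._≈_ 𝕂 (Characteristic.PrimeSubfield.value a) (HeytingField.0# 𝕂)) where
  open MasterFunction 𝕂 p char 2<p n r Λ a a≉0
  open Characteristic 𝕂 using (PrimeSubfield)
  open PrimeSubfield using (value)
  open PositiveCharacteristic 𝕂 p char 2<p using (bar; bar-exists; -2ₚ)
  open FractionField K[s,x] using (embed-cong; embed-+; embed-neg; *ᶠ-noZeroDivisors)
  open FractionFieldProperties K[s,x]
  open IntegralDomain fracDomain hiding (zero)
  open Products *-commutativeMonoid hiding (∏)
  open DifferenceEquation fracDomain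

  private
    module K = IntegralDomain (fieldDomain 𝕂)
    module A = IntegralDomain K[s,x]
    module Z = MPoly (fieldDomain 𝕂)
    module KMult = SemiringMult K.semiring
    open MonoidMult K.+-monoid using () renaming (_×_ to _×ₙ_; ×-congʳ to ×ₙ-congʳ; ×-congˡ to ×ₙ-congˡ)

    -- Names, by unification, the family of factors of ∏[ P? ] f, which a where clause hides.
    vectorOf : ∀ {N u} {v : Vector Carrier N} → u ≡ ∏ v → Vector Carrier N
    vectorOf {v = v} _ = v

  -- Makes the lemmas on `guarded` available for the restricted products in `F` and `Φ`.
  ∏[]≈∏-guarded : ∀ {N} {P : Fin N → Set} (P? : ∀ j → Dec (P j)) (f : ∀ j → P j → Carrier) →
    ∏[ P? ] f ≈ ∏ λ j → guarded (P? j) (f j)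
  ∏[]≈∏-guarded {N} P? f = ∏-cong {N} {factors} pointwise
    where
    factors : Vector Carrier N
    factors = vectorOf {u = ∏[ P? ] f} ≡.refl
    pointwise : ∀ j → factors j ≈ guarded (P? j) (f j)
    pointwise j with P? j
    ... | yes Pj = refl
    ... | no _   = refl

  const-cong : ∀ {k l} → k K.≈ l → const k ≈ const l
  const-cong k≈l = embed-cong (Z.constant-cong (r ℕ.+ n) k≈l)

  -- The progression in `g` stops one step short of b. The bound `1 ≤ k` ensures that the truncated
  -- subtraction is undone by the successor.
  1+[bar∸1]×a≈b : ∀ b → suc (bar a a≉0 b ∸ 1) ×ₙ value a K.≈ value b
  1+[bar∸1]×a≈b b with bar-exists a a≉0 b
  ... | k , 1≤k , _ , ak≈b = begin
    suc (k ∸ 1) ×ₙ value a       ≈⟨ ×ₙ-congˡ (ℕ.m+[n∸m]≡n 1≤k) ⟩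
    k ×ₙ value a                 ≈⟨ ×ₙ-congʳ k (K.*-identityʳ (value a)) ⟨
    k ×ₙ (value a K.* K.1#)      ≈⟨ KMult.×-comm-* k (value a) K.1# ⟨
    value a K.* (k ×ₙ K.1#)      ≈⟨ ak≈b ⟩
    value b                      ∎
    where open SetoidReasoning K.setoid

  -- The free `β` lets the constant -2 appear as `- (1# + 1#)` in the function field, the form
  -- `pair` expects.
  g-shiftSolution : ∀ b {β} → const (value b) ≈ β → ShiftSolution aᶜ β λ y → g y b
  g-shiftSolution b {β} b≈β = progression-shiftSolution aᶜ (λ i → const (i ×ₙ value a))
    (const-cong (K.+-identityʳ (value a)))
    (λ i → sym (const-+ (value a) (i ×ₙ value a)))
    (bar a a≉0 b ∸ 1) β
    (trans (const-cong (1+[bar∸1]×a≈b b)) b≈β)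

  const-2 : const (value -2ₚ) ≈ - (1# + 1#)
  const-2 = trans (sym (const-neg (K.1# K.+ K.1#)))
    (-‿cong (trans (sym (const-+ K.1# K.1#)) (+-cong (sym const-1) (sym const-1))))

  open Master n r aᶜ (const ∘ value ∘ Λ) (λ m y → g y (Λ m)) (λ m → g-shiftSolution (Λ m) refl)
    (λ y → g y -2ₚ) (g-shiftSolution -2ₚ const-2)

  F≈master : ∀ s x → F s x ≈ master s x
  F≈master s x = *-congˡ {x = ∏ λ m → ∏ λ l → g (s l - x m) (Λ m)}
    (∏-cong {r} λ k → ∏[]≈∏-guarded (_<? k) λ j _ → (s k - s j) * g (s k - s j + 1#) -2ₚ)

  -- Every linear factor of `F` is a difference of two distinct variables plus a constant. One
  -- traversal therefore serves every multiplicative property, here being a polynomial and being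
  -- nonzero.
  F-all : ∀ {q} (Q : Carrier → Set q) → (∀ {u w} → u ≈ w → Q u → Q w) →
    Q 1# → (∀ {u w} → Q u → Q w → Q (u * w)) →
    (∀ i j → i ≢ j → ∀ k → Q (v i - v j + const k)) → Q (F s x)
  F-all Q resp q1 _*q_ qv = resp (sym (F≈master s x))
    (∏-all Q q1 _*q_ (λ m → ∏-all Q q1 _*q_ λ l → ∏-all {N = bar a a≉0 (Λ m) ∸ 1} Q q1 _*q_ λ i →
       qv (l ↑ˡ n) (r ↑ʳ m) (s≢x l m) (suc (toℕ i) ×ₙ value a))
     *q
     ∏-all Q q1 _*q_ λ k → ∏-all Q q1 _*q_ λ j → guarded-all (j <? k) Q q1 λ j<k →
       let k≢j = λ eq → Fin.<-irrefl (≡.sym (Fin.↑ˡ-injective n k j eq)) j<k in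
       -- The bare difference is the case of the constant 0.
       resp (trans (+-congˡ {x = s k - s j} (sym const-0)) (+-identityʳ (s k - s j)))
         (qv (k ↑ˡ n) (j ↑ˡ n) k≢j K.0#)
       *q
       ∏-all {N = bar a a≉0 -2ₚ ∸ 1} Q q1 _*q_ λ i → let kᵢ = suc (toℕ i) ×ₙ value a in
         -- The 1 in the argument of `g` is absorbed into the constant.
         resp (sym (trans (+-assoc (s k - s j) 1# (const kᵢ))
                (+-congˡ {x = s k - s j} (trans (+-congʳ {x = const kᵢ} const-1) (const-+ K.1# kᵢ)))))
           (qv (k ↑ˡ n) (j ↑ˡ n) k≢j (K.1# K.+ kᵢ)))
    where
    s≢x : ∀ l m → l ↑ˡ n ≢ r ↑ʳ m
    s≢x l m eq with ≡.trans (≡.sym (Fin.splitAt-↑ˡ r l n))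
                      (≡.trans (≡.cong (splitAt r) eq) (Fin.splitAt-↑ʳ r n m))
    ... | ()

  F-isPolynomial : IsPolynomial (F s x)
  F-isPolynomial = F-all IsPolynomial (λ u≈w (P , u≈P) → P , trans (sym u≈w) u≈P)
    (A.1# , refl)
    (λ {u} {w} (P , u≈P) (P′ , w≈P′) → P A.* P′ ,
      trans (*-cong {u} {embed P} {w} {embed P′} u≈P w≈P′) (sym (embed-* P P′)))
    λ i j _ k →
      let zi = Z.indeterminate i ; zj = Z.indeterminate j ; zk = Z.constant (r ℕ.+ n) k in
      zi A.- zj A.+ zk ,
      sym (trans (embed-+ (zi A.- zj) zk)
        (+-congʳ {x = const k} (trans (embed-+ zi (A.- zj)) (+-congˡ {x = v i} (embed-neg zj)))))

  F≉0 : ¬ F s x ≈ 0#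
  F≉0 = F-all (λ u → ¬ u ≈ 0#) (λ u≈w u≉0 w≈0 → u≉0 (trans u≈w w≈0)) 1≉0 noZeroDivisors v-v+k≉0

  F-isMasterFunction : IsMasterFunction F
  F-isMasterFunction = F≉0 , Φ≈ , Ψ≈
    where
    Φ≈ : ∀ l → Φ l ≈ F (updateAt s l (_+ aᶜ)) x / F s x ⟨ F≉0 ⟩
    -- Dividing by the nonzero `F s x` is left to the end; what is shown is the product form.
    Φ≈ l = *⇒/ (Φ l) (F s x) (F s′ x) F≉0 (begin
      Φ l * F s x
        ≈⟨ *-cong {Φ l} {∏ u * ∏ w}
             (*-congˡ {x = ∏ u} (∏[]≈∏-guarded (λ j → ¬? (j ≟ l)) quotient)) (F≈master s x) ⟩
      ∏ u * ∏ w * master s x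
        ≈⟨ master-shift-s s x l u w (s-x+a≉0 l)
          (λ m → /-*-cancel (s l - x m + const (value (Λ m))) (s l - x m + aᶜ) (s-x+a≉0 l m))
          s-s+1+a≉0
          (λ {j} j≢l → guarded-yes (¬? (j ≟ l)) (λ wⱼ → wⱼ * denominator j ≈ numerator j) j≢l
            λ j≢l → /-*-cancel (numerator j) (denominator j) (denominator≉0 j≢l))
          (guarded-no (¬? (l ≟ l)) λ l≢l → l≢l ≡.refl) ⟩
      master s′ x
        ≈⟨ F≈master s′ x ⟨
      F s′ x ∎)
      where
      open SetoidReasoning setoid
      s′ = updateAt s l (_+ aᶜ)
      u : Vector Carrier n
      u m = (s l - x m + const (value (Λ m))) / (s l - x m + aᶜ) ⟨ s-x+a≉0 l m ⟩
      numerator denominator : Vector Carrier r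
      numerator j   = (s l - s j + aᶜ) * (s l - s j - 1#)
      denominator j = (s l - s j) * (s l - s j + 1# + aᶜ)
      denominator≉0 : ∀ {j} → j ≢ l → ¬ denominator j ≈ 0#
      denominator≉0 j≢l = *ᶠ-noZeroDivisors (s-s≉0 j≢l) (s-s+1+a≉0 j≢l)
      quotient : ∀ j → j ≢ l → Carrier
      quotient j j≢l = numerator j / denominator j ⟨ denominator≉0 j≢l ⟩
      w : Vector Carrier r
      w j = guarded (¬? (j ≟ l)) (quotient j)

    Ψ≈ : ∀ m → Ψ m ≈ F s (updateAt x m (_+ aᶜ)) / F s x ⟨ F≉0 ⟩
    Ψ≈ m = *⇒/ (Ψ m) (F s x) (F s x′) F≉0 (begin
      Ψ m * F s x               ≈⟨ *-congˡ {x = Ψ m} (F≈master s x) ⟩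
      -- The omitted vector is the family of factors of `Ψ m`.
      Ψ m * master s x  ≈⟨ master-shift-x s x m _ (λ j → s-x+Λ-a≉0 j m)
          (λ j → /-*-cancel (s j - x m) (s j - x m + const (value (Λ m)) - aᶜ) (s-x+Λ-a≉0 j m)) ⟩
      master s x′       ≈⟨ F≈master s x′ ⟨
      F s x′                    ∎)
      where
      open SetoidReasoning setoid
      x′ = updateAt x m (_+ aᶜ)

lemma7p1 : {c ℓ₁ ℓ₂ : Level} (𝕂 : HeytingField c ℓ₁ ℓ₂) (let open Characteristic 𝕂)
    (p : ℕ) (char : HasCharacteristic p) (2<p : 2 < p)
    (n r : ℕ) → 1 ≤ n → 1 ≤ r →
    (Λ : Fin n → PrimeSubfield)
    (a : PrimeSubfield) (a≉0 : ¬ HeytingField._≈_ 𝕂 (PrimeSubfield.value a) (HeytingField.0# 𝕂)) →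
    let open MasterFunction 𝕂 p char 2<p n r Λ a a≉0 in
    IsPolynomial (F s x) × IsMasterFunction F
lemma7p1 𝕂 p char 2<p n r _ _ Λ a a≉0 = F-isPolynomial , F-isMasterFunction
  where open MasterFunctionProperties 𝕂 p char 2<p n r Λ a a≉0
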